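{- Let $Q$ be the dual quiver of a cylindric 2-loop plabic network whose faces are labeled $a_1,\dots,a_\ell$, $b_1,\dots,b_m$, $c_1,\dots,c_n$ with trail weight $t$ as in the context. Set the $y$-variable at each vertex of $Q$ equal to the weight of the corresponding face and apply $\tau=\mu_1\mu_2\cdots\mu_{n-2}s_{n-1,n}\mu_n\cdots\mu_1$ (on the middle circle vertices $1,\dots,n$, vertex $i$ corresponding to face $c_i$). Then the resulting $y$-variables are equal to the face weights $(a',b',c')=T_f(a,b,c)$ of the corresponding faces.
   Context: Cylindric 2-loop plabic network: a plabic graph on a cylinder (rectangle with boundary components left and right, top and bottom identified) coming from a Postnikov diagram (black vertices in counterclockwise faces, white in clockwise faces, joined when faces share a corner) with exactly two strands that are loops around the cylinder with the same orientation, giving a left and a right string of alternating black/white vertices; there are no other vertices. Black left-string vertices have extra edges to the left boundary, white left-string vertices to the right string, black right-string vertices to the left string, white right-string vertices to the right boundary. Canonical orientation: string edges upward, others left to right. Face weights: product of weights of clockwise-oriented boundary edges times inverses of counterclockwise ones; trail: sequence of adjacent vertices between boundary components, weight = product of forward edge weights times inverses of backward ones. Labels: the trail is a 5-edge path (left boundary to a black left-string vertex, one edge up the left string, across to the right string, one edge up the right string, to the right boundary) of weight $t$. Left faces (between left boundary and left string) $a_1,\dots,a_\ell$ starting above the trail going up; right faces $b_1,\dots,b_m$; faces between the strings $c_1,\dots,c_{n-1},c_n$ with $c_n=\frac{1}{a_1\cdots a_\ell b_1\cdots b_mc_1\cdots c_{n-1}}$; indices modular. $a_j$ is associated to $i$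 if the highest left-string edge bordering $a_j$ also borders $c_i$; $b_j$ is associated to $i$ if the lowest right-string edge bordering $b_j$ also borders $c_i$. Convert to edge weights on the expanded graph (split vertices with several edges to the other string, inserting opposite-color vertices, new edges weight 1): white-to-black left-string edge highest on $a_j$ gets $a_j^{ -1}$; white-to-black right-string edge lowest on $b_j$ gets $b_j$; other string edges 1; the trail's crossing edge $t$; the crossing edge between $c_i$ and $c_{i+1}$ gets $t\big(\prod_{a_j\text{ assoc. to }k\le i}a_j\big)\big(\prod_{b_j\text{ assoc. to }k\le i}b_j\big)\big(\prod_{j\le i}c_j\big)$. Name these $x_1,\dots,x_n$ (white-to-black left-string edges going up), $y_1,\dots,y_n$ (same on the right string, with $y_1=b_1$), $z_i$ the crossing edge from the lower endpoint of $x_{i+1}$ to the upper endpoint of $y_i$; put $\widehat\lambda_i=\sum_{j=i}^{i+n-1}\big(\prod_{k=i+1}^jx_k\big)z_j\big(\prod_{k=j+1}^{i+n-1}y_k\big)$ (indices mod $n$). Then $T_f(a,b,c)=(a',b',c')$ where $a_i'=\widehat\lambda_j/\big(\widehat\lambda_p\prod_{b_r\text{ assoc. to }s,\,p\le s<j}b_r\big)$ ($a_i$ associated to $j$, $a_{i-1}$ to $p$); $b_i'=\widehat\lambda_q/\big(\widehat\lambda_j\prod_{a_r\text{ assoc. to }s,\,j<s\le q}a_r\big)$ ($b_i$ associated to $j$, $b_{i+1}$ to $q$); $c_i'=c_i\widehat\lambda_{i-1}\big(\prod_{a_r\text{ assoc. to }s,\,i\le s\le i+1}a_r\big)\big(\prod_{b_r\text{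 assoc. to }s,\,i-1\le s\le i}b_r\big)/\widehat\lambda_{i+1}$. Quivers and mutation: a quiver is a directed graph without loops or 2-cycles; $y$-seed mutation $\mu_k$ mutates the quiver at $k$ (add $i\to j$ for each $i\to k\to j$, reverse arrows at $k$, cancel 2-cycles), sets $y_k'=y_k^{ -1}$, and for $i\ne k$ sets $y_i'=y_i(1+y_k^{ -1})^{ -m}$ if there are $m$ arrows $k\to i$, $y_i'=y_i(1+y_k)^m$ if there are $m$ arrows $i\to k$; $s_{n-1,n}$ transposes vertices $n-1,n$; sequences are applied rightmost first. A spider web quiver has concentric circles (here three) with at least 2 vertices each, circle edges oriented counterclockwise, and arrows between adjacent circles making every face a directed cycle with exactly two arrows between circles and at least 3 sides. The dual quiver $Q$ has one vertex per face of the network and arrows across the edges separating faces (standard plabic-graph dual convention); it is a spider web quiver whose outer circle consists of the faces $a_j$, whose middle circle consists of $c_1,\dots,c_n$ labeled $1,\dots,n$ following the arrows (vertex $i$ = face $c_i$), and whose inner circle consists of the faces $b_j$. -}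

module Defs where

open import Level using (Level; _⊔_) renaming (suc to lsuc)
open import Data.Nat as ℕ using (ℕ; zero; suc; _∸_; NonZero)
open import Data.Nat.DivMod using (_mod_)
open import Data.Fin as Fin using (Fin; toℕ)
open import Data.Fin.Properties using () renaming (_≟_ to _≟F_)
open import Data.Integer as ℤ using (ℤ; +_; -[1+_])
open import Data.Bool using (Bool; true; false; if_then_else_)
open import Data.List using (List; []; _∷_; foldl; upTo; downFrom)
open import Data.Product using (_×_; _,_)
open import Relation.Nullary using (yes; no; Dec; does)
open import Relation.Binary.PropositionalEquality using (_≡_; refl; cong)
open import Relation.Binary.Core using (Rel)
open import Algebra.Core using (Op₁; Op₂)
open import Algebra.Definitions using (_DistributesOver_)
open import Algebra.Structures using (IsCommutativeSemigroup; IsAbelianGroup)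

record Semifield (c ℓ : Level) : Set (lsuc (c ⊔ ℓ)) where
  infixl 7 _*_
  infixl 6 _+_
  field
    Carrier : Set c
    _≈_     : Rel Carrier ℓ
    _+_     : Op₂ Carrier
    _*_     : Op₂ Carrier
    1#      : Carrier
    _⁻¹     : Op₁ Carrier
    +-isCommutativeSemigroup : IsCommutativeSemigroup _≈_ _+_
    *-isAbelianGroup         : IsAbelianGroup _≈_ _*_ 1# _⁻¹
    distrib                  : _DistributesOver_ _≈_ _*_ _+_

-- Vertices of the dual quiver: faces a_j (j : Fin ℓ), b_j (j : Fin m),
-- c_i (i : Fin n).  All indices are 0-based: Fin index k stands for the
-- paper's index k+1 (so e.g. the paper's c_n is  vc (n-1)).

data Vtx (ℓ m n : ℕ) : Set where
  va : Fin ℓ → Vtx ℓ m n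
  vb : Fin m → Vtx ℓ m n
  vc : Fin n → Vtx ℓ m n

module _ {ℓ m n : ℕ} where

  _≟V_ : (u v : Vtx ℓ m n) → Dec (u ≡ v)
  va i ≟V va j with i ≟F j
  ... | yes refl = yes refl
  ... | no ne = no λ { refl → ne refl }
  va _ ≟V vb _ = no λ ()
  va _ ≟V vc _ = no λ ()
  vb _ ≟V va _ = no λ ()
  vb i ≟V vb j with i ≟F j
  ... | yes refl = yes refl
  ... | no ne = no λ { refl → ne refl }
  vb _ ≟V vc _ = no λ ()
  vc _ ≟V va _ = no λ ()
  vc _ ≟V vb _ = no λ ()
  vc i ≟V vc j with i ≟F j
  ... | yes refl = yes refl
  ... | no ne = no λ { refl → ne refl }

  -- A quiver without loops and 2-cycles on the vertex set Vtx, encoded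
  -- as its skew-symmetric exchange matrix: Mat u v = #(u → v) − #(v → u).
  Mat : Set
  Mat = Vtx ℓ m n → Vtx ℓ m n → ℤ

  count : List (Vtx ℓ m n × Vtx ℓ m n) → Vtx ℓ m n → Vtx ℓ m n → ℕ
  count [] u v = 0
  count ((s , t) ∷ as) u v with does (s ≟V u) | does (t ≟V v)
  ... | true | true = suc (count as u v)
  ... | _    | _    = count as u v

  quiverOf : List (Vtx ℓ m n × Vtx ℓ m n) → Mat
  quiverOf as u v = (+ count as u v) ℤ.- (+ count as v u)

  pos : ℤ → ℕ
  pos (+ k) = k
  pos -[1+ _ ] = 0

  -- quiver mutation at k: for each path i → k → j add an arrow i → j,
  -- reverse the arrows at k, cancel 2-cycles (signed count).
  mutQ : Vtx ℓ m n → Mat → Mat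
  mutQ k B i j with does (i ≟V k) | does (j ≟V k)
  ... | true  | _     = ℤ.- B i j
  ... | false | true  = ℤ.- B i j
  ... | false | false =
        (B i j ℤ.+ (+ (pos (B i k) ℕ.* pos (B k j))))
          ℤ.- (+ (pos (B j k) ℕ.* pos (B k i)))

  swapV : Vtx ℓ m n → Vtx ℓ m n → Vtx ℓ m n → Vtx ℓ m n
  swapV p q w with does (w ≟V p) | does (w ≟V q)
  ... | true  | _     = q
  ... | false | true  = p
  ... | false | false = w

module YSeeds {c₁ ℓ₁ : Level} (S : Semifield c₁ ℓ₁) where
  open Semifield S

  _/_ : Carrier → Carrier → Carrier
  x / y = x * (y ⁻¹)

  pow : Carrier → ℕ → Carrier
  pow x zero    = 1#
  pow x (suc k) = x * pow x k

  prodR : (ℕ → Carrier) → ℕ → ℕ → Carrier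
  prodR f lo zero      = 1#
  prodR f lo (suc len) = f lo * prodR f (suc lo) len

  prodF : ∀ {k} → (Fin k → Carrier) → Carrier
  prodF {zero}  f = 1#
  prodF {suc k} f = f Fin.zero * prodF (λ i → f (Fin.suc i))

  sumUpTo : ℕ → (ℕ → Carrier) → Carrier
  sumUpTo zero    f = f 0
  sumUpTo (suc k) f = sumUpTo k f + f (suc k)

  module _ {ℓ m n : ℕ} where

    record YSeed : Set c₁ where
      constructor yseed
      field
        quiver : Mat {ℓ} {m} {n}
        yvar   : Vtx ℓ m n → Carrier
    open YSeed public

    μ : Vtx ℓ m n → YSeed → YSeed
    μ k (yseed B y) = yseed (mutQ k B) y′
      where
      y′ : Vtx ℓ m n → Carrier
      y′ i with does (i ≟V k)
      ... | true  = y k ⁻¹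
      ... | false with B i k
      ...   | + p      = y i * pow (1# + y k) p                      -- p arrows i → k
      ...   | -[1+ p ] = y i * (pow (1# + y k ⁻¹) (suc p)) ⁻¹        -- p+1 arrows k → i

    swapSeed : Vtx ℓ m n → Vtx ℓ m n → YSeed → YSeed
    swapSeed p q (yseed B y) =
      yseed (λ u v → B (swapV p q u) (swapV p q v)) (λ w → y (swapV p q w))

-- The cylindric 2-loop plabic network, parametrised by its association
-- data, with face weights a, b, c and trail weight t.

module Network {c₁ ℓ₁ : Level} (S : Semifield c₁ ℓ₁)
               (n ℓ m : ℕ) ⦃ _ : NonZero n ⦄ ⦃ _ : NonZero ℓ ⦄ ⦃ _ : NonZero m ⦄
               (α : Fin ℓ → Fin n)   -- a_j associated to α j
               (β : Fin m → Fin n)   -- b_j associated to β j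
               (t : Semifield.Carrier S)
               (a : Fin ℓ → Semifield.Carrier S)
               (b : Fin m → Semifield.Carrier S)
               (c : Fin n → Semifield.Carrier S)
               where
  open Semifield S
  open YSeeds S

  [_]ₙ : ℕ → Fin n
  [ i ]ₙ = i mod n
  [_]ₗ : ℕ → Fin ℓ
  [ i ]ₗ = i mod ℓ
  [_]ₘ : ℕ → Fin m
  [ i ]ₘ = i mod m

  -- x/y/z edge weights of the expanded graph (0-based, indices mod n)
  X : Fin n → Carrier
  X k = prodF (λ j → if does (α j ≟F k) then a j ⁻¹ else 1#)

  Y : Fin n → Carrier
  Y k = prodF (λ j → if does (β j ≟F k) then b j else 1#)

  -- Z k = weight of the crossing edge between c_k and c_{k+1} (0-based);
  -- the last one (between c_{n-1} and c_0, paper: c_n and c_1) is the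
  -- trail's crossing edge, of weight t.
  Z : Fin n → Carrier
  Z k with does (suc (toℕ k) ℕ.≟ n)
  ... | true  = t
  ... | false =
    t * prodF (λ j → if does (toℕ (α j) ℕ.≤? toℕ k) then a j else 1#)
      * prodF (λ j → if does (toℕ (β j) ℕ.≤? toℕ k) then b j else 1#)
      * prodF (λ i → if does (toℕ i ℕ.≤? toℕ k) then c i else 1#)

  x y z : ℕ → Carrier
  x k = X [ k ]ₙ
  y k = Y [ k ]ₙ
  z k = Z [ k ]ₙ

  λ̂ : ℕ → Carrier
  λ̂ i = sumUpTo (n ∸ 1) (λ d →
          prodR x (suc i) d * z (i ℕ.+ d) * prodR y (suc (i ℕ.+ d)) (n ∸ 1 ∸ d))

  PA PB : ℕ → Carrier
  PA s = prodF (λ r → if does (α r ≟F [ s ]ₙ) then a r else 1#)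
  PB s = prodF (λ r → if does (β r ≟F [ s ]ₙ) then b r else 1#)

  -- length of the cyclic interval from p (inclusive) to q (exclusive)
  cycLen : ℕ → ℕ → ℕ
  cycLen p q = toℕ [ q ℕ.+ n ∸ p ]ₙ

  a′ : Fin ℓ → Carrier
  a′ i = λ̂ j / (λ̂ p * prodR PB p (cycLen p j))
    where
    j = toℕ (α i)
    p = toℕ (α [ toℕ i ℕ.+ ℓ ∸ 1 ]ₗ)

  b′ : Fin m → Carrier
  b′ i = λ̂ q / (λ̂ j * prodR PA (suc j) (cycLen j q))
    where
    j = toℕ (β i)
    q = toℕ (β [ suc (toℕ i) ]ₘ)

  c′ : Fin n → Carrier
  c′ i = (c i * λ̂ (k ℕ.+ n ∸ 1) * prodR PA k 2 * prodR PB (k ℕ.+ n ∸ 1) 2) / λ̂ (suc k)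
    where
    k = toℕ i

  Tf : Vtx ℓ m n → Carrier
  Tf (va j) = a′ j
  Tf (vb j) = b′ j
  Tf (vc i) = c′ i

  -- the dual quiver Q: one arrow across each edge of the plabic graph
  -- (boundary edges, string edges, crossing edges)
  arrows : List (Vtx ℓ m n × Vtx ℓ m n)
  arrows = circA (upTo ℓ) (circB (upTo m) (circC (upTo n) []))
    where
    circA : List ℕ → List (Vtx ℓ m n × Vtx ℓ m n) → List (Vtx ℓ m n × Vtx ℓ m n)
    circA [] r = r
    circA (j ∷ js) r =
      (va [ j ]ₗ , va [ suc j ]ₗ) ∷              -- left boundary edge
      (va [ j ]ₗ , vc (α [ j ℕ.+ ℓ ∸ 1 ]ₗ)) ∷    -- lowest left-string edge of a_j
      (vc (α [ j ]ₗ) , va [ j ]ₗ) ∷              -- highest left-string edge of a_j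
      circA js r
    circB : List ℕ → List (Vtx ℓ m n × Vtx ℓ m n) → List (Vtx ℓ m n × Vtx ℓ m n)
    circB [] r = r
    circB (j ∷ js) r =
      (vb [ j ]ₘ , vb [ suc j ]ₘ) ∷              -- right boundary edge
      (vb [ j ]ₘ , vc (β [ j ]ₘ)) ∷              -- lowest right-string edge of b_j
      (vc (β [ suc j ]ₘ) , vb [ j ]ₘ) ∷          -- highest right-string edge of b_j
      circB js r
    circC : List ℕ → List (Vtx ℓ m n × Vtx ℓ m n) → List (Vtx ℓ m n × Vtx ℓ m n)
    circC [] r = r
    circC (i ∷ is) r = (vc [ i ]ₙ , vc [ suc i ]ₙ) ∷ circC is r   -- crossing edge z_i

  Q : Mat {ℓ} {m} {n}
  Q = quiverOf arrows

  faceWeight : Vtx ℓ m n → Carrier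
  faceWeight (va j) = a j
  faceWeight (vb j) = b j
  faceWeight (vc i) = c i

  initialSeed : YSeed {ℓ} {m} {n}
  initialSeed = yseed Q faceWeight

  mutateAll : List ℕ → YSeed {ℓ} {m} {n} → YSeed {ℓ} {m} {n}
  mutateAll ks s = foldl (λ acc k → μ (vc [ k ]ₙ) acc) s ks

  -- τ = μ_1 μ_2 ⋯ μ_{n-2} s_{n-1,n} μ_n ⋯ μ_1  (rightmost first);
  -- 0-based: μ at 0,1,…,n-1, then swap (n-2,n-1), then μ at n-3,…,0
  τ : YSeed {ℓ} {m} {n} → YSeed {ℓ} {m} {n}
  τ s = mutateAll (downFrom (n ∸ 2))
          (swapSeed (vc [ n ∸ 2 ]ₙ) (vc [ n ∸ 1 ]ₙ)
            (mutateAll (upTo n) s))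

{-# OPTIONS --safe #-}
module Submission where

-- With 0-based indices and n = N + 2, τ is M⁻¹ σ M, where M mutates at
-- 0, …, N − 1 and σ mutates at N and N + 1 and then swaps these two vertices.
-- Mutation is an involution, so it suffices that σ applied to M(a,b,c) is
-- M(T(a,b,c)), both runs of M starting from the quiver Q.
--
-- Let P k = c₀⋯c₍ₖ₋₁₎, D = P n, and let W k = P k + ⋯ + P (k + n − 1).  Up to
-- monomials in x, y and t, λ̂ᵢ is W (i + 1), and T becomes
--   cᵢ ↦ cᵢ W i / W (i + 2),   w ↦ w W (q + 1) / W (p + 1)
-- for an outer or inner face w with arrows w → c_p and c_q → w, with an extra
-- factor D if q < p.  Only the entries of the quiver in the columns that are
-- still to be mutated matter for M; before the mutation at k every vertex has
-- in the columns k, …, n − 1 a row of the form e_p − e_q, and the weight at k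
-- is P (k + 1) / (P 0 + ⋯ + P k).  The quotient of the two runs at a
-- vertex is then a function of (p , q) alone, and it evolves consistently by
--   (P 0 + ⋯ + P k) W (k + 2) + P (k + 1) W 0 = (P 0 + ⋯ + P (k + 1)) W (k + 1).

-- The descending half M⁻¹ is never computed. Both runs go upwards from one quiver and are compared
-- at the top, where only two columns are left. This requires σ to fix the quiver reached by M:
-- there every row is e_p - e_q on the last two columns, so its two entries are opposite, and what
-- the mutations change is restored by the swap.
--
-- The sums W arise because in each summand of λ̂ the products of x, of y and the monomial part of z
-- telescope to a factor common to all summands. That all face weights multiply to 1 makes the
-- monomial of the crossing weights periodic, so the crossing edge of the trail is no exception.
--
-- P and W by themselves are only quasi-periodic: W (n + k) = D W k. This shapes the bookkeeping. A
-- quotient of two W depends on the representatives of the cyclic indices, so it is attached to a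
-- pair (p , q) of numbers below n, and rows that pass the cut need D. Middle vertices not yet
-- mutated are off by D⁻¹. Both corrections resolve themselves: mutation at a vertex inverts its
-- weight and absorbs the D⁻¹, while σ divides the last two weights, whose product is D, by D each.

open import Defs
open import Level using (Level; _⊔_)
open import Algebra.Bundles using (AbelianGroup)
open import Data.Nat as ℕ using (ℕ; zero; suc; _∸_; NonZero; _<_; _≤_; _<?_; _≤?_)
import Data.Nat.Properties as ℕP
open import Data.Nat.DivMod using (_mod_; _%_; m<n⇒m%n≡m; m%n<n; [m+n]%n≡m%n; m≡m%n+[m/n]*n) renaming (_/_ to _div_)
open import Data.Integer as ℤ using (ℤ; +_; -[1+_])
import Data.Integer.Properties as ℤP
open import Data.Fin as Fin using (Fin; toℕ)
open import Data.Fin.Properties using (toℕ-fromℕ<; toℕ-injective; toℕ<n) renaming (_≟_ to _≟F_)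
open import Data.Bool using (Bool; true; false; if_then_else_; _∧_; T)
open import Data.Bool.Properties using (∧-comm)
open import Data.Product using (_×_; _,_; proj₁; proj₂; ∃₂)
open import Data.Sum using (_⊎_; inj₁; inj₂; [_,_]′)
open import Data.List using (List; []; _∷_; upTo; downFrom; applyUpTo)
open import Data.List.Properties using (foldl-∷ʳ; upTo-∷ʳ)
open import Data.Vec using ([]; _∷_; map; allFin)
open import Data.Vec.N-ary using (N-ary; _$ⁿ_)
open import Function using (id; _∘_; _⇔_; mk⇔)
open import Relation.Nullary using (does; yes; no; ¬_; Dec)
open import Relation.Nullary.Decidable using (dec-true; dec-false; does-⇔)
open import Relation.Nullary.Negation using (contradiction)
open import Relation.Binary.Definitions using (tri<; tri≈; tri>)
open import Relation.Binary.PropositionalEquality as ≡ using (_≡_; _≢_; cong; cong₂; module ≡-Reasoning)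

-- Abelian groups and semifields

-- Reduction to commutative monoids by clearing denominators: an expression is split into `num` and
-- `den`, and two quotients agree once their cross products have the same monoid normal form.
module AbelianGroupSolver {g₁ g₂} (G : AbelianGroup g₁ g₂) where
  open AbelianGroup G
  open import Algebra.Properties.AbelianGroup G using (⁻¹-involutive; ⁻¹-∙-comm; ε⁻¹≈ε)
  open import Algebra.Solver.CommutativeMonoid.Normal commutativeMonoid as M using (Expr; Env; ⟦_⟧⇓; normalise)
  open import Relation.Binary.Reasoning.Setoid setoid
  open import Algebra.Properties.CommutativeSemigroup commutativeSemigroup using (interchange)

  infixl 6 _⊕_ _⊖_
  data GroupExpr (k : ℕ) : Set where
    var  : Fin k → GroupExpr k
    zero : GroupExpr k
    _⊕_  : GroupExpr k → GroupExpr k → GroupExpr k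
    neg  : GroupExpr k → GroupExpr k

  _⊖_ : ∀ {k} → GroupExpr k → GroupExpr k → GroupExpr k
  e ⊖ f = e ⊕ neg f

  ⟦_⟧ : ∀ {k} → GroupExpr k → Env k → Carrier
  ⟦ var i ⟧ ρ = M.⟦ M.var i ⟧ ρ
  ⟦ zero ⟧ ρ  = ε
  ⟦ e ⊕ f ⟧ ρ = ⟦ e ⟧ ρ ∙ ⟦ f ⟧ ρ
  ⟦ neg e ⟧ ρ = ⟦ e ⟧ ρ ⁻¹

  num den : ∀ {k} → GroupExpr k → Expr k
  num (var i) = M.var i
  num zero    = M.id
  num (e ⊕ f) = num e M.⊕ num f
  num (neg e) = den e
  den (var i) = M.id
  den zero    = M.id
  den (e ⊕ f) = den e M.⊕ den f
  den (neg e) = num e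

  fraction : ∀ {k} (e : GroupExpr k) ρ → ⟦ e ⟧ ρ ≈ M.⟦ num e ⟧ ρ - M.⟦ den e ⟧ ρ
  fraction (var i) ρ = sym (trans (∙-congˡ ε⁻¹≈ε) (identityʳ _))
  fraction zero ρ    = sym (inverseʳ _)
  fraction (e ⊕ f) ρ = begin
    ⟦ e ⟧ ρ ∙ ⟦ f ⟧ ρ                              ≈⟨ ∙-cong (fraction e ρ) (fraction f ρ) ⟩
    (M.⟦ num e ⟧ ρ - M.⟦ den e ⟧ ρ) ∙ (M.⟦ num f ⟧ ρ - M.⟦ den f ⟧ ρ) ≈⟨ interchange _ _ _ _ ⟩
    (M.⟦ num e ⟧ ρ ∙ M.⟦ num f ⟧ ρ) ∙ (M.⟦ den e ⟧ ρ ⁻¹ ∙ M.⟦ den f ⟧ ρ ⁻¹) ≈⟨ ∙-congˡ (⁻¹-∙-comm _ _) ⟩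
    (M.⟦ num e ⟧ ρ ∙ M.⟦ num f ⟧ ρ) - (M.⟦ den e ⟧ ρ ∙ M.⟦ den f ⟧ ρ) ∎
  fraction (neg e) ρ = begin
    ⟦ e ⟧ ρ ⁻¹                          ≈⟨ ⁻¹-cong (fraction e ρ) ⟩
    (M.⟦ num e ⟧ ρ - M.⟦ den e ⟧ ρ) ⁻¹  ≈⟨ ⁻¹-∙-comm _ _ ⟨
    M.⟦ num e ⟧ ρ ⁻¹ ∙ M.⟦ den e ⟧ ρ ⁻¹ ⁻¹ ≈⟨ ∙-congˡ (⁻¹-involutive _) ⟩
    M.⟦ num e ⟧ ρ ⁻¹ ∙ M.⟦ den e ⟧ ρ    ≈⟨ comm _ _ ⟩
    M.⟦ den e ⟧ ρ - M.⟦ num e ⟧ ρ       ∎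

  cross : ∀ {a b c d} → a ∙ d ≈ c ∙ b → a - b ≈ c - d
  cross {a} {b} {c} {d} eq = begin
    a - b               ≈⟨ ∙-congʳ (trans (sym (identityʳ a)) (∙-congˡ (sym (inverseʳ d)))) ⟩
    (a ∙ (d - d)) - b   ≈⟨ ∙-congʳ (sym (assoc _ _ _)) ⟩
    ((a ∙ d) - d) - b   ≈⟨ ∙-congʳ (∙-congʳ eq) ⟩
    ((c ∙ b) - d) - b   ≈⟨ trans (assoc _ _ _) (∙-congˡ (comm _ _)) ⟩
    (c ∙ b) ∙ (b ⁻¹ - d) ≈⟨ trans (assoc _ _ _) (∙-congˡ (sym (assoc _ _ _))) ⟩
    c ∙ ((b - b) - d)   ≈⟨ ∙-congˡ (trans (∙-congʳ (inverseʳ b)) (identityˡ _)) ⟩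
    c - d               ∎

  prove : ∀ {k} (e f : GroupExpr k) → normalise (num e M.⊕ den f) ≡ normalise (num f M.⊕ den e) →
          ∀ ρ → ⟦ e ⟧ ρ ≈ ⟦ f ⟧ ρ
  prove e f eq ρ = begin
    ⟦ e ⟧ ρ                        ≈⟨ fraction e ρ ⟩
    M.⟦ num e ⟧ ρ - M.⟦ den e ⟧ ρ  ≈⟨ cross cleared ⟩
    M.⟦ num f ⟧ ρ - M.⟦ den f ⟧ ρ  ≈⟨ fraction f ρ ⟨
    ⟦ f ⟧ ρ                        ∎
    where
    cleared : M.⟦ num e M.⊕ den f ⟧ ρ ≈ M.⟦ num f M.⊕ den e ⟧ ρ
    cleared = begin
      M.⟦ num e M.⊕ den f ⟧ ρ               ≈⟨ M.correct (num e M.⊕ den f) ρ ⟨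
      ⟦ normalise (num e M.⊕ den f) ⟧⇓ ρ   ≡⟨ ≡.cong (λ v → ⟦ v ⟧⇓ ρ) eq ⟩
      ⟦ normalise (num f M.⊕ den e) ⟧⇓ ρ   ≈⟨ M.correct (num f M.⊕ den e) ρ ⟩
      M.⟦ num f M.⊕ den e ⟧ ρ               ∎

  infix 4 _⊜_
  _⊜_ : ∀ {k} → GroupExpr k → GroupExpr k → GroupExpr k × GroupExpr k
  _⊜_ = _,_

  solve : ∀ k (eqn : N-ary k (GroupExpr k) (GroupExpr k × GroupExpr k)) →
          let e = proj₁ (eqn $ⁿ map var (allFin k)) ; f = proj₂ (eqn $ⁿ map var (allFin k)) in
          normalise (num e M.⊕ den f) ≡ normalise (num f M.⊕ den e) →
          ∀ ρ → ⟦ e ⟧ ρ ≈ ⟦ f ⟧ ρ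
  solve k eqn = prove (proj₁ (eqn $ⁿ map var (allFin k))) (proj₂ (eqn $ⁿ map var (allFin k)))

module SemifieldProperties {c₁ ℓ₁ : Level} (S : Semifield c₁ ℓ₁) where
  open Semifield S renaming (_≈_ to infix 4 _≈_; _⁻¹ to infixl 8 _⁻¹)
  open YSeeds S renaming (_/_ to infixl 7 _/_)

  *-abelianGroup : AbelianGroup c₁ ℓ₁
  *-abelianGroup = record { isAbelianGroup = *-isAbelianGroup }

  open AbelianGroup *-abelianGroup public
    using (setoid; refl; sym; trans; reflexive; identityˡ; identityʳ; inverseʳ; inverseˡ)
    renaming (∙-cong to *-cong; ∙-congˡ to *-congˡ; ∙-congʳ to *-congʳ; ⁻¹-cong to ⁻¹-cong;
              assoc to *-assoc; comm to *-comm)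
  open import Algebra.Structures _≈_ using (IsCommutativeSemigroup)
  open IsCommutativeSemigroup +-isCommutativeSemigroup public
    using ()
    renaming (∙-cong to +-cong; ∙-congˡ to +-congˡ; ∙-congʳ to +-congʳ; assoc to +-assoc; comm to +-comm)
  open AbelianGroupSolver *-abelianGroup public using (solve; _⊕_; _⊖_; neg; zero; _⊜_)
  open import Relation.Binary.Reasoning.Setoid setoid

  distribˡ : ∀ x y z → x * (y + z) ≈ x * y + x * z
  distribˡ = proj₁ distrib
  distribʳ : ∀ x y z → (y + z) * x ≈ y * x + z * x
  distribʳ = proj₂ distrib

  pow-one : ∀ x → pow x 1 ≈ x
  pow-one x = identityʳ x

  ⁻¹-involutive : ∀ x → (x ⁻¹) ⁻¹ ≈ x
  ⁻¹-involutive x = solve 1 (λ a → neg (neg a) ⊜ a) ≡.refl (x ∷ [])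

  pow-cong : ∀ {x y} k → x ≈ y → pow x k ≈ pow y k
  pow-cong zero    e = refl
  pow-cong (suc k) e = *-cong e (pow-cong k e)

  -- Brings the factor along an arrow leaving the mutated vertex to the denominator `1# + x`, which
  -- is also the factor along an arrow entering it; both signs then need only one computation of
  -- `1# + x`.
  1+inverse : ∀ x → (1# + x ⁻¹) ⁻¹ ≈ x / (1# + x)
  1+inverse x = begin
    (1# + x ⁻¹) ⁻¹            ≈⟨ solve 2 (λ a b → neg b ⊜ a ⊖ (a ⊕ b)) ≡.refl (x ∷ (1# + x ⁻¹) ∷ []) ⟩
    x / (x * (1# + x ⁻¹))     ≈⟨ *-congˡ (⁻¹-cong (distribˡ _ _ _)) ⟩
    x / (x * 1# + x * x ⁻¹)   ≈⟨ *-congˡ (⁻¹-cong (+-cong (identityʳ x) (inverseʳ x))) ⟩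
    x / (x + 1#)              ≈⟨ *-congˡ (⁻¹-cong (+-comm _ _)) ⟩
    x / (1# + x)              ∎

  1+fraction : ∀ x y → 1# + x / y ≈ (y + x) / y
  1+fraction x y = begin
    1# + x / y       ≈⟨ +-congʳ (sym (inverseʳ y)) ⟩
    y / y + x / y    ≈⟨ distribʳ _ _ _ ⟨
    (y + x) / y      ∎

  sumUpTo-cong : ∀ k {f g} → (∀ i → f i ≈ g i) → sumUpTo k f ≈ sumUpTo k g
  sumUpTo-cong zero    h = h 0
  sumUpTo-cong (suc k) h = +-cong (sumUpTo-cong k h) (h (suc k))

  sumUpTo-cong≤ : ∀ k {f g} → (∀ i → i ℕ.≤ k → f i ≈ g i) → sumUpTo k f ≈ sumUpTo k g
  sumUpTo-cong≤ zero    h = h 0 ℕP.≤-refl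
  sumUpTo-cong≤ (suc k) h =
    +-cong (sumUpTo-cong≤ k λ i i≤k → h i (ℕP.m≤n⇒m≤1+n i≤k)) (h (suc k) ℕP.≤-refl)

  sumUpTo-*ˡ : ∀ k x f → x * sumUpTo k f ≈ sumUpTo k (λ i → x * f i)
  sumUpTo-*ˡ zero    x f = refl
  sumUpTo-*ˡ (suc k) x f = trans (distribˡ _ _ _) (+-congʳ (sumUpTo-*ˡ k x f))

  sumUpTo-split : ∀ j k f → sumUpTo (k ℕ.+ suc j) f ≈ sumUpTo j f + sumUpTo k (λ i → f (i ℕ.+ suc j))
  sumUpTo-split j zero    f = refl
  sumUpTo-split j (suc k) f = trans (+-congʳ (sumUpTo-split j k f)) (+-assoc _ _ _)

  prodR-cong : ∀ {f g} → (∀ i → f i ≈ g i) → ∀ lo len → prodR f lo len ≈ prodR g lo len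
  prodR-cong h lo zero      = refl
  prodR-cong h lo (suc len) = *-cong (h lo) (prodR-cong h (suc lo) len)

  prodR-split : ∀ f lo j k → prodR f lo (j ℕ.+ k) ≈ prodR f lo j * prodR f (lo ℕ.+ j) k
  prodR-split f lo zero k = trans (reflexive (≡.cong (λ i → prodR f i k) (≡.sym (ℕP.+-identityʳ lo)))) (sym (identityˡ _))
  prodR-split f lo (suc j) k = begin
    f lo * prodR f (suc lo) (j ℕ.+ k) ≈⟨ *-congˡ (prodR-split f (suc lo) j k) ⟩
    f lo * (prodR f (suc lo) j * prodR f (suc lo ℕ.+ j) k) ≈⟨ *-assoc _ _ _ ⟨
    f lo * prodR f (suc lo) j * prodR f (suc lo ℕ.+ j) k
      ≡⟨ ≡.cong (λ i → f lo * prodR f (suc lo) j * prodR f i k) (ℕP.+-suc lo j) ⟨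
    f lo * prodR f (suc lo) j * prodR f (lo ℕ.+ suc j) k ∎

  prodR-suc : ∀ f k → prodR f 0 (suc k) ≈ prodR f 0 k * f k
  prodR-suc f k = begin
    prodR f 0 (suc k)       ≡⟨ ≡.cong (prodR f 0) (ℕP.+-comm 1 k) ⟩
    prodR f 0 (k ℕ.+ 1)     ≈⟨ prodR-split f 0 k 1 ⟩
    prodR f 0 k * (f k * 1#) ≈⟨ *-congˡ (identityʳ _) ⟩
    prodR f 0 k * f k       ∎

  -- Reduces products over intervals to prefix products, after which every telescoping is a
  -- cancellation for the group solver.
  prodR-quotient : ∀ f lo len → prodR f lo len ≈ prodR f 0 (lo ℕ.+ len) / prodR f 0 lo
  prodR-quotient f lo len = begin
    prodR f lo len
      ≈⟨ solve 2 (λ a b → a ⊜ b ⊕ a ⊖ b) ≡.refl (prodR f lo len ∷ prodR f 0 lo ∷ []) ⟩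
    (prodR f 0 lo * prodR f lo len) / prodR f 0 lo
      ≈⟨ *-congʳ (sym (prodR-split f 0 lo len)) ⟩
    prodR f 0 (lo ℕ.+ len) / prodR f 0 lo ∎

  prodR-shift : ∀ f m → (∀ i → f (m ℕ.+ i) ≈ f i) → ∀ lo len → prodR f (m ℕ.+ lo) len ≈ prodR f lo len
  prodR-shift f m h lo zero = refl
  prodR-shift f m h lo (suc len) = *-cong (h lo)
    (trans (reflexive (≡.cong (λ i → prodR f i len) (≡.sym (ℕP.+-suc m lo)))) (prodR-shift f m h (suc lo) len))

  prodR-periodic : ∀ f m → (∀ i → f (m ℕ.+ i) ≈ f i) → ∀ k → prodR f 0 (m ℕ.+ k) ≈ prodR f 0 m * prodR f 0 k
  prodR-periodic f m h k = trans (prodR-split f 0 m k)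
    (*-congˡ (trans (reflexive (≡.cong (λ i → prodR f i k) (≡.sym (ℕP.+-identityʳ m)))) (prodR-shift f m h 0 k)))

  prodR-⁻¹ : ∀ f lo len → prodR (λ i → f i ⁻¹) lo len ≈ prodR f lo len ⁻¹
  prodR-⁻¹ f lo zero = solve 0 (zero ⊜ neg zero) ≡.refl []
  prodR-⁻¹ f lo (suc len) = trans (*-congˡ (prodR-⁻¹ f (suc lo) len))
    (solve 2 (λ a b → neg a ⊕ neg b ⊜ neg (a ⊕ b)) ≡.refl (f lo ∷ prodR f (suc lo) len ∷ []))

  prodF-cong : ∀ {k} {f g : Fin k → Carrier} → (∀ i → f i ≈ g i) → prodF f ≈ prodF g
  prodF-cong {zero}  h = refl
  prodF-cong {suc k} h = *-cong (h Fin.zero) (prodF-cong λ i → h (Fin.suc i))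

  prodF-* : ∀ {k} (f g : Fin k → Carrier) → prodF (λ i → f i * g i) ≈ prodF f * prodF g
  prodF-* {zero}  f g = sym (identityˡ _)
  prodF-* {suc k} f g = trans (*-congˡ (prodF-* (λ i → f (Fin.suc i)) (λ i → g (Fin.suc i))))
    (solve 4 (λ a b c d → (a ⊕ b) ⊕ (c ⊕ d) ⊜ (a ⊕ c) ⊕ (b ⊕ d)) ≡.refl (_ ∷ _ ∷ _ ∷ _ ∷ []))

  prodF-1 : ∀ k → prodF {k} (λ _ → 1#) ≈ 1#
  prodF-1 zero    = refl
  prodF-1 (suc k) = trans (identityˡ _) (prodF-1 k)

  prodF-⁻¹ : ∀ {k} (f : Fin k → Carrier) → prodF (λ i → f i ⁻¹) ≈ prodF f ⁻¹
  prodF-⁻¹ {zero}  f = solve 0 (zero ⊜ neg zero) ≡.refl []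
  prodF-⁻¹ {suc k} f = trans (*-congˡ (prodF-⁻¹ λ i → f (Fin.suc i)))
    (solve 2 (λ a b → neg a ⊕ neg b ⊜ neg (a ⊕ b)) ≡.refl (_ ∷ _ ∷ []))

  infix 9 _when_
  _when_ : Carrier → Bool → Carrier
  x when p = if p then x else 1#

  prodF-single : ∀ {k} (f : Fin k → Carrier) j → prodF (λ i → f i when does (i ≟F j)) ≈ f j
  prodF-single {suc k} f Fin.zero = trans (*-congˡ (prodF-1 k)) (identityʳ _)
  prodF-single {suc k} f (Fin.suc j) = trans (identityˡ _)
    (trans (prodF-cong λ i → reflexive (≡.cong (f (Fin.suc i) when_) (suc-does i)))
           (prodF-single (λ i → f (Fin.suc i)) j))
    where
    suc-does : ∀ i → does (Fin.suc i ≟F Fin.suc j) ≡ does (i ≟F j)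
    suc-does i with i ≟F j
    ... | yes _ = ≡.refl
    ... | no _  = ≡.refl

  prodF-add : ∀ {k} (f : Fin k → Carrier) (p q : Fin k → Bool) j →
              p j ≡ false → q j ≡ true → (∀ i → i ≢ j → p i ≡ q i) →
              prodF (λ i → f i when q i) ≈ prodF (λ i → f i when p i) * f j
  prodF-add f p q j pj qj same = begin
    prodF (λ i → f i when q i)
      ≈⟨ prodF-cong pointwise ⟩
    prodF (λ i → f i when p i * f i when does (i ≟F j))
      ≈⟨ prodF-* (λ i → f i when p i) (λ i → f i when does (i ≟F j)) ⟩
    prodF (λ i → f i when p i) * prodF (λ i → f i when does (i ≟F j))
      ≈⟨ *-congˡ (prodF-single f j) ⟩
    prodF (λ i → f i when p i) * f j ∎
    where
    pointwise : ∀ i → f i when q i ≈ f i when p i * f i when does (i ≟F j)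
    pointwise i with i ≟F j
    ... | yes ≡.refl rewrite pj | qj = sym (identityˡ _)
    ... | no i≢j     rewrite same i i≢j = sym (identityʳ _)

-- Mutation

module ℤIdentities where
  open AbelianGroupSolver ℤP.+-0-abelianGroup renaming (zero to 0#)

  neg-minus : ∀ a b → ℤ.- (a ℤ.- b) ≡ b ℤ.- a
  neg-minus a b = solve 2 (λ a b → neg (a ⊖ b) ⊜ b ⊖ a) ≡.refl (a ∷ b ∷ [])

  neg-plus-minus : ∀ a b c → (ℤ.- a ℤ.+ b) ℤ.- c ≡ ℤ.- ((a ℤ.+ c) ℤ.- b)
  neg-plus-minus a b c = solve 3 (λ a b c → (neg a ⊕ b) ⊖ c ⊜ neg ((a ⊕ c) ⊖ b)) ≡.refl (a ∷ b ∷ c ∷ [])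

  plus-minus-plus-minus : ∀ a b c → (((a ℤ.+ b) ℤ.- c) ℤ.+ c) ℤ.- b ≡ a
  plus-minus-plus-minus a b c = solve 3 (λ a b c → (((a ⊕ b) ⊖ c) ⊕ c) ⊖ b ⊜ a) ≡.refl (a ∷ b ∷ c ∷ [])

  plus-zero-minus-zero : ∀ a → (a ℤ.+ + 0) ℤ.- + 0 ≡ a
  plus-zero-minus-zero a = solve 1 (λ a → (a ⊕ 0#) ⊖ 0# ⊜ a) ≡.refl (a ∷ [])

  zero-minus-plus : ∀ a b → (+ 0 ℤ.- a) ℤ.+ b ≡ b ℤ.- a
  zero-minus-plus a b = solve 2 (λ a b → (0# ⊖ a) ⊕ b ⊜ b ⊖ a) ≡.refl (a ∷ b ∷ [])

  minus-self : ∀ a b → a ℤ.- a ≡ b ℤ.- b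
  minus-self a b = solve 2 (λ a b → a ⊖ a ⊜ b ⊖ b) ≡.refl (a ∷ b ∷ [])

open ℤIdentities using (neg-minus; neg-plus-minus; plus-minus-plus-minus; plus-zero-minus-zero; zero-minus-plus; minus-self)

module _ {ℓ m n : ℕ} where

  Skew : Mat {ℓ} {m} {n} → Set
  Skew B = ∀ u v → B u v ≡ ℤ.- B v u

  quiverOf-skew : ∀ as → Skew (quiverOf as)
  quiverOf-skew as u v = ≡.sym (neg-minus (+ count as v u) (+ count as u v))

  mutQ-self-row : ∀ (k : Vtx ℓ m n) B j → mutQ k B k j ≡ ℤ.- B k j
  mutQ-self-row k B j with k ≟V k
  ... | yes _  = ≡.refl
  ... | no k≢k = contradiction ≡.refl k≢k

  mutQ-self-col : ∀ (k : Vtx ℓ m n) B i → mutQ k B i k ≡ ℤ.- B i k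
  mutQ-self-col k B i with i ≟V k | k ≟V k
  ... | yes _ | _      = ≡.refl
  ... | no _  | yes _  = ≡.refl
  ... | no _  | no k≢k = contradiction ≡.refl k≢k

  through : ℤ → ℤ → ℤ
  through p q = + (pos {ℓ} {m} {n} p ℕ.* pos {ℓ} {m} {n} q)

  through-comm : ∀ p q → through p q ≡ through q p
  through-comm p q = cong +_ (ℕP.*-comm (pos {ℓ} {m} {n} p) (pos {ℓ} {m} {n} q))

  mutQ-other : ∀ {i j} (k : Vtx ℓ m n) B → i ≢ k → j ≢ k →
               mutQ k B i j ≡ (B i j ℤ.+ through (B i k) (B k j)) ℤ.- through (B j k) (B k i)
  mutQ-other {i} {j} k B i≢k j≢k with i ≟V k | j ≟V k
  ... | yes i≡k | _       = contradiction i≡k i≢k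
  ... | no _    | yes j≡k = contradiction j≡k j≢k
  ... | no _    | no _    = ≡.refl

  mutQ-skew : ∀ k B → Skew B → Skew (mutQ k B)
  mutQ-skew k B sk u v with u ≟V k | v ≟V k
  ... | yes _ | yes _ = cong ℤ.-_ (sk u v)
  ... | yes _ | no _  = cong ℤ.-_ (sk u v)
  ... | no _  | yes _ = cong ℤ.-_ (sk u v)
  ... | no _  | no _  = ≡.trans
    (cong (λ x → (x ℤ.+ through (B u k) (B k v)) ℤ.- through (B v k) (B k u)) (sk u v))
    (neg-plus-minus (B v u) _ _)

  -- Mutating twice: the paths through k contribute with opposite signs,
  -- since reversing the arrows at k exchanges B u k with B k u.
  paths-cancel : ∀ b {p q p′ q′} → p′ ≡ p → q′ ≡ q →
                 (((b ℤ.+ p) ℤ.- q) ℤ.+ q′) ℤ.- p′ ≡ b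
  paths-cancel b {p} {q} ≡.refl ≡.refl = plus-minus-plus-minus b p q

  neg-row : ∀ {B} → Skew B → ∀ u v → ℤ.- B u v ≡ B v u
  neg-row sk u v = ≡.sym (sk v u)

  mutQ-involutive : ∀ k B → Skew B → ∀ u v → mutQ k (mutQ k B) u v ≡ B u v
  mutQ-involutive k B sk u v = by (u ≟V k) (v ≟V k)
    where
    B₁ = mutQ k B
    row : ∀ v → B₁ k v ≡ B v k
    row v = ≡.trans (mutQ-self-row k B v) (neg-row sk k v)
    col : ∀ u → B₁ u k ≡ B k u
    col u = ≡.trans (mutQ-self-col k B u) (neg-row sk u k)
    by : Dec (u ≡ k) → Dec (v ≡ k) → mutQ k B₁ u v ≡ B u v
    by (yes ≡.refl) _ = ≡.trans (mutQ-self-row k B₁ v)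
      (≡.trans (cong ℤ.-_ (mutQ-self-row k B v)) (ℤP.neg-involutive _))
    by (no _) (yes ≡.refl) = ≡.trans (mutQ-self-col k B₁ u)
      (≡.trans (cong ℤ.-_ (mutQ-self-col k B u)) (ℤP.neg-involutive _))
    by (no u≢k) (no v≢k) = begin
      mutQ k B₁ u v
        ≡⟨ mutQ-other k B₁ u≢k v≢k ⟩
      (B₁ u v ℤ.+ through (B₁ u k) (B₁ k v)) ℤ.- through (B₁ v k) (B₁ k u)
        ≡⟨ cong₂ ℤ._-_ (cong₂ ℤ._+_ (mutQ-other k B u≢k v≢k) (cong₂ through (col u) (row v)))
                       (cong₂ through (col v) (row u)) ⟩
      (((B u v ℤ.+ through (B u k) (B k v)) ℤ.- through (B v k) (B k u))
        ℤ.+ through (B k u) (B v k)) ℤ.- through (B k v) (B u k)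
        ≡⟨ paths-cancel (B u v) (through-comm (B k v) (B u k)) (through-comm (B k u) (B v k)) ⟩
      B u v ∎
      where open ≡-Reasoning

module Seeds {c₁ ℓ₁ : Level} (S : Semifield c₁ ℓ₁) {ℓ m n : ℕ} where
  open Semifield S renaming (_≈_ to infix 4 _≈_; _⁻¹ to infixl 8 _⁻¹)
  open YSeeds S renaming (_/_ to infixl 7 _/_)
  open SemifieldProperties S
  open import Relation.Binary.Reasoning.Setoid setoid

  -- The factor that `μ` hides in a `with`, with the quiver entry as an argument, so that a known
  -- entry can be substituted.
  exchange : ℤ → Carrier → Carrier → Carrier
  exchange (+ p)    x z = x * pow (1# + z) p
  exchange -[1+ p ] x z = x * (pow (1# + z ⁻¹) (suc p)) ⁻¹

  μ-self : ∀ k (s : YSeed {ℓ} {m} {n}) → yvar (μ k s) k ≡ yvar s k ⁻¹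
  μ-self k s with k ≟V k
  ... | yes _  = ≡.refl
  ... | no k≢k = contradiction ≡.refl k≢k

  μ-other : ∀ {u} k (s : YSeed {ℓ} {m} {n}) → u ≢ k →
            yvar (μ k s) u ≡ exchange (quiver s u k) (yvar s u) (yvar s k)
  μ-other {u} k s u≢k with u ≟V k
  ... | yes u≡k = contradiction u≡k u≢k
  ... | no _ with quiver s u k
  ...   | + p      = ≡.refl
  ...   | -[1+ p ] = ≡.refl

  exchange-cong : ∀ r {x x′ z z′} → x ≈ x′ → z ≈ z′ → exchange r x z ≈ exchange r x′ z′
  exchange-cong (+ p)    ex ez = *-cong ex (pow-cong p (+-congˡ ez))
  exchange-cong -[1+ p ] ex ez = *-cong ex (⁻¹-cong (pow-cong (suc p) (+-congˡ (⁻¹-cong ez))))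

  exchange-zero : ∀ x z → exchange (+ 0) x z ≈ x
  exchange-zero x z = identityʳ x

  exchange-one : ∀ x z → exchange (+ 1) x z ≈ x * (1# + z)
  exchange-one x z = *-congˡ (pow-one _)

  exchange-minus-one : ∀ x z → exchange -[1+ 0 ] x z ≈ x * (z / (1# + z))
  exchange-minus-one x z = *-congˡ (trans (⁻¹-cong (pow-one _)) (1+inverse z))

  exchange-inverse : ∀ r x z → exchange (ℤ.- r) (exchange r x z) (z ⁻¹) ≈ x
  exchange-inverse (+ zero) x z = trans (identityʳ _) (identityʳ x)
  exchange-inverse (+ suc p) x z = begin
    x * pow (1# + z) (suc p) * (pow (1# + z ⁻¹ ⁻¹) (suc p)) ⁻¹
      ≈⟨ *-congˡ (⁻¹-cong (pow-cong (suc p) (+-congˡ (⁻¹-involutive z)))) ⟩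
    x * pow (1# + z) (suc p) * (pow (1# + z) (suc p)) ⁻¹
      ≈⟨ trans (*-assoc _ _ _) (trans (*-congˡ (inverseʳ _)) (identityʳ x)) ⟩
    x ∎
  exchange-inverse -[1+ p ] x z =
    trans (*-assoc _ _ _) (trans (*-congˡ (inverseˡ _)) (identityʳ x))

  -- Mutations at the middle vertices never look at the other entries of the quiver.
  record _≃_ (s s′ : YSeed {ℓ} {m} {n}) : Set (c₁ ⊔ ℓ₁) where
    field
      col : ∀ u j → quiver s u (vc j) ≡ quiver s′ u (vc j)
      row : ∀ j u → quiver s (vc j) u ≡ quiver s′ (vc j) u
      yv  : ∀ u → yvar s u ≈ yvar s′ u
  open _≃_ public

  ≃-trans : ∀ {s s′ s″} → s ≃ s′ → s′ ≃ s″ → s ≃ s″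
  ≃-trans e f = record
    { col = λ u j → ≡.trans (col e u j) (col f u j)
    ; row = λ j u → ≡.trans (row e j u) (row f j u)
    ; yv  = λ u → trans (yv e u) (yv f u) }

  mutQ-congˢ : ∀ {B B′ : Mat {ℓ} {m} {n}} k u v → B u v ≡ B′ u v → B u k ≡ B′ u k → B k v ≡ B′ k v →
               B v k ≡ B′ v k → B k u ≡ B′ k u → mutQ k B u v ≡ mutQ k B′ u v
  mutQ-congˢ k u v e₁ e₂ e₃ e₄ e₅ with u ≟V k | v ≟V k
  ... | yes _ | _     = cong ℤ.-_ e₁
  ... | no _  | yes _ = cong ℤ.-_ e₁
  ... | no _  | no _  = cong₂ ℤ._-_ (cong₂ ℤ._+_ e₁ (cong₂ (through {ℓ} {m} {n}) e₂ e₃))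
                                    (cong₂ (through {ℓ} {m} {n}) e₄ e₅)

  μ-cong : ∀ k {s s′} → s ≃ s′ → μ (vc k) s ≃ μ (vc k) s′
  μ-cong k {s} {s′} e = record
    { col = λ u j → mutQ-congˢ (vc k) u (vc j) (col e u j) (col e u k) (col e (vc k) j) (col e (vc j) k) (row e k u)
    ; row = λ j u → mutQ-congˢ (vc k) (vc j) u (row e j u) (col e (vc j) k) (row e k u) (col e u k) (col e (vc k) j)
    ; yv  = λ u → values u (u ≟V vc k) }
    where
    values : ∀ u → Dec (u ≡ vc k) → yvar (μ (vc k) s) u ≈ yvar (μ (vc k) s′) u
    values u (yes ≡.refl) = begin
      yvar (μ u s) u  ≡⟨ μ-self u s ⟩
      yvar s u ⁻¹     ≈⟨ ⁻¹-cong (yv e u) ⟩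
      yvar s′ u ⁻¹    ≡⟨ μ-self u s′ ⟨
      yvar (μ u s′) u ∎
    values u (no u≢k) = begin
      yvar (μ (vc k) s) u                                        ≡⟨ μ-other (vc k) s u≢k ⟩
      exchange (quiver s u (vc k)) (yvar s u) (yvar s (vc k))    ≡⟨ cong (λ r → exchange r _ _) (col e u k) ⟩
      exchange (quiver s′ u (vc k)) (yvar s u) (yvar s (vc k))   ≈⟨ exchange-cong (quiver s′ u (vc k)) (yv e u) (yv e (vc k)) ⟩
      exchange (quiver s′ u (vc k)) (yvar s′ u) (yvar s′ (vc k)) ≡⟨ μ-other (vc k) s′ u≢k ⟨
      yvar (μ (vc k) s′) u                                       ∎

  μ-involutive : ∀ k s → Skew (quiver s) → μ (vc k) (μ (vc k) s) ≃ s
  μ-involutive k s sk = record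
    { col = λ u j → mutQ-involutive (vc k) (quiver s) sk u (vc j)
    ; row = λ j u → mutQ-involutive (vc k) (quiver s) sk (vc j) u
    ; yv  = λ u → values u (u ≟V vc k) }
    where
    s₁ = μ (vc k) s
    values : ∀ u → Dec (u ≡ vc k) → yvar (μ (vc k) s₁) u ≈ yvar s u
    values u (yes ≡.refl) = begin
      yvar (μ u s₁) u   ≡⟨ μ-self u s₁ ⟩
      yvar s₁ u ⁻¹      ≡⟨ cong _⁻¹ (μ-self u s) ⟩
      yvar s u ⁻¹ ⁻¹    ≈⟨ ⁻¹-involutive _ ⟩
      yvar s u          ∎
    values u (no u≢k) = begin
      yvar (μ (vc k) s₁) u
        ≡⟨ μ-other (vc k) s₁ u≢k ⟩
      exchange (quiver s₁ u (vc k)) (yvar s₁ u) (yvar s₁ (vc k))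
        ≡⟨ ≡.cong₂ {A = ℤ} (λ r x → exchange r x (yvar s₁ (vc k))) (mutQ-self-col (vc k) (quiver s) u) (μ-other (vc k) s u≢k) ⟩
      exchange (ℤ.- quiver s u (vc k)) (exchange (quiver s u (vc k)) (yvar s u) (yvar s (vc k))) (yvar s₁ (vc k))
        ≡⟨ cong (exchange (ℤ.- quiver s u (vc k)) (exchange (quiver s u (vc k)) (yvar s u) (yvar s (vc k)))) (μ-self (vc k) s) ⟩
      exchange (ℤ.- quiver s u (vc k)) (exchange (quiver s u (vc k)) (yvar s u) (yvar s (vc k))) (yvar s (vc k) ⁻¹)
        ≈⟨ exchange-inverse (quiver s u (vc k)) _ _ ⟩
      yvar s u ∎

-- The dual quiver

indicator : Bool → ℕ
indicator p = if p then 1 else 0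

-- The coordinate at `i` of the unit vector e_p; rows of the quiver are differences of two such
-- vectors.
δ : ℕ → ℕ → ℤ
δ p i = + indicator (does (p ℕ.≟ i))

toℕ-mod : ∀ {k} n ⦃ _ : NonZero n ⦄ → k < n → toℕ (k mod n) ≡ k
toℕ-mod {k} n k<n = ≡.trans (toℕ-fromℕ< (m%n<n k n)) (m<n⇒m%n≡m k<n)

mod-toℕ : ∀ {n} ⦃ _ : NonZero n ⦄ (i : Fin n) → toℕ i mod n ≡ i
mod-toℕ {n} i = toℕ-injective (toℕ-mod n (toℕ<n i))

countIf : (ℕ → Bool) → List ℕ → ℕ
countIf f []       = 0
countIf f (j ∷ js) = indicator (f j) ℕ.+ countIf f js

countIf-none : ∀ f (g : ℕ → ℕ) k → (∀ i → i < k → f (g i) ≡ false) → countIf f (applyUpTo g k) ≡ 0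
countIf-none f g zero    none = ≡.refl
countIf-none f g (suc k) none rewrite none 0 ℕ.z<s =
  countIf-none f (g ∘ suc) k (λ i i<k → none (suc i) (ℕ.s<s i<k))

countIf-single : ∀ f (g : ℕ → ℕ) k i₀ → i₀ < k → (∀ i → i < k → i ≢ i₀ → f (g i) ≡ false) →
                 countIf f (applyUpTo g k) ≡ indicator (f (g i₀))
countIf-single f g (suc k) zero _ other
  rewrite countIf-none f (g ∘ suc) k (λ i i<k → other (suc i) (ℕ.s<s i<k) λ ()) = ℕP.+-identityʳ _
countIf-single f g (suc k) (suc i₀) i₀<k other rewrite other 0 ℕ.z<s (λ ()) =
  countIf-single f (g ∘ suc) k i₀ (ℕ.s<s⁻¹ i₀<k)
    (λ i i<k i≢i₀ → other (suc i) (ℕ.s<s i<k) (i≢i₀ ∘ ℕP.suc-injective))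

-- Exactly one index of the list reduces to `j`, so counting the arrows of a whole circle becomes
-- evaluation at `toℕ j`.
countIf-mod : ∀ {k} ⦃ _ : NonZero k ⦄ (j : Fin k) (p : ℕ → Bool) →
              countIf (λ i → does (i mod k ≟F j) ∧ p i) (upTo k) ≡ indicator (p (toℕ j))
countIf-mod {k} j p = ≡.trans
  (countIf-single f id k (toℕ j) (toℕ<n j)
    (λ i i<k i≢j → cong (_∧ p i) (dec-false (i mod k ≟F j)
      (λ eq → i≢j (≡.trans (≡.sym (toℕ-mod k i<k)) (cong toℕ eq))))))
  (cong (λ q → indicator (q ∧ p (toℕ j))) (dec-true (toℕ j mod k ≟F j) (mod-toℕ j)))
  where
  f : ℕ → Bool
  f i = does (i mod k ≟F j) ∧ p i

∧-comm-countIf : ∀ (p q : ℕ → Bool) js → countIf (λ i → p i ∧ q i) js ≡ countIf (λ i → q i ∧ p i) js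
∧-comm-countIf p q []       = ≡.refl
∧-comm-countIf p q (j ∷ js) = cong₂ (λ x y → indicator x ℕ.+ y) (∧-comm (p j) (q j)) (∧-comm-countIf p q js)

module _ {ℓ m n : ℕ} where

  count-∷ : ∀ (s t : Vtx ℓ m n) as u v →
            count ((s , t) ∷ as) u v ≡ indicator (does (s ≟V u) ∧ does (t ≟V v)) ℕ.+ count as u v
  count-∷ s t as u v with does (s ≟V u) | does (t ≟V v)
  ... | true  | true  = ≡.refl
  ... | true  | false = ≡.refl
  ... | false | _     = ≡.refl

  -- `j` counts the matches within the circle under inspection, `k` those in the rest of the list.
  -- The record keeps all five parameters visible to unification, which could not recover them from
  -- the sum or from `count` once these reduce.
  record Counts (as : List (Vtx ℓ m n × Vtx ℓ m n)) (u v : Vtx ℓ m n) (j k : ℕ) : Set where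
    constructor counts
    field total : count as u v ≡ j ℕ.+ k
  open Counts public

  miss : ∀ {s t u v as j k} → ¬ (s ≡ u × t ≡ v) → Counts as u v j k → Counts ((s , t) ∷ as) u v j k
  miss {s} {t} {u} {v} {as} no-match (counts eq) =
    counts (≡.trans (count-∷ s t as u v) (≡.trans (cong (λ i → indicator i ℕ.+ count as u v) unequal) eq))
    where
    unequal : does (s ≟V u) ∧ does (t ≟V v) ≡ false
    unequal with s ≟V u | t ≟V v
    ... | yes e | yes f = contradiction (e , f) no-match
    ... | yes _ | no _  = ≡.refl
    ... | no _  | _     = ≡.refl

  hit : ∀ {s t u v as j k p q} → does (s ≟V u) ≡ p → does (t ≟V v) ≡ q → Counts as u v j k →
        Counts ((s , t) ∷ as) u v (indicator (p ∧ q) ℕ.+ j) k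
  hit {s} {t} {u} {v} {as} {j} {k} ≡.refl ≡.refl (counts eq) = counts (≡.trans (count-∷ s t as u v)
    (≡.trans (cong (λ i → indicator (does (s ≟V u) ∧ does (t ≟V v)) ℕ.+ i) eq) (≡.sym (ℕP.+-assoc _ j k))))

  does-va : ∀ i j → does (va {ℓ} {m} {n} i ≟V va j) ≡ does (i ≟F j)
  does-va i j = does-⇔ (mk⇔ (λ { ≡.refl → ≡.refl }) (cong va)) (va {ℓ} {m} {n} i ≟V va j) (i ≟F j)
  does-vb : ∀ i j → does (vb {ℓ} {m} {n} i ≟V vb j) ≡ does (i ≟F j)
  does-vb i j = does-⇔ (mk⇔ (λ { ≡.refl → ≡.refl }) (cong vb)) (vb {ℓ} {m} {n} i ≟V vb j) (i ≟F j)
  does-vc : ∀ i j → does (vc {ℓ} {m} {n} i ≟V vc j) ≡ does (i ≟F j)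
  does-vc i j = does-⇔ (mk⇔ (λ { ≡.refl → ≡.refl }) (cong vc)) (vc {ℓ} {m} {n} i ≟V vc j) (i ≟F j)

module DualQuiver {c₁ ℓ₁ : Level} (S : Semifield c₁ ℓ₁)
    (n ℓ m : ℕ) ⦃ _ : NonZero n ⦄ ⦃ _ : NonZero ℓ ⦄ ⦃ _ : NonZero m ⦄
    (α : Fin ℓ → Fin n) (β : Fin m → Fin n)
    (t : Semifield.Carrier S)
    (a : Fin ℓ → Semifield.Carrier S)
    (b : Fin m → Semifield.Carrier S)
    (c : Fin n → Semifield.Carrier S) where
  open Network S n ℓ m α β t a b c

  Arrow : Set
  Arrow = Vtx ℓ m n × Vtx ℓ m n

  leftArrows rightArrows middleArrows : List ℕ → List Arrow → List Arrow
  leftArrows [] r = r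
  leftArrows (j ∷ js) r =
      (va [ j ]ₗ , va [ suc j ]ₗ) ∷
      (va [ j ]ₗ , vc (α [ j ℕ.+ ℓ ∸ 1 ]ₗ)) ∷
      (vc (α [ j ]ₗ) , va [ j ]ₗ) ∷
      leftArrows js r
  rightArrows [] r = r
  rightArrows (j ∷ js) r =
      (vb [ j ]ₘ , vb [ suc j ]ₘ) ∷
      (vb [ j ]ₘ , vc (β [ j ]ₘ)) ∷
      (vc (β [ suc j ]ₘ) , vb [ j ]ₘ) ∷
      rightArrows js r
  middleArrows [] r = r
  middleArrows (i ∷ is) r = (vc [ i ]ₙ , vc [ suc i ]ₙ) ∷ middleArrows is r

  middles = middleArrows (upTo n) []
  rights  = rightArrows (upTo m) middles

  -- The left-hand sides _ stand for the local functions of arrows, which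
  -- have no name here; they are found by unification with arrows itself.
  mutual
    arrows-eq : arrows ≡ leftArrows (upTo ℓ) rights
    arrows-eq with upTo ℓ
    ... | js = left-eq js

    left-eq : ∀ js → _ ≡ leftArrows js rights
    left-eq [] with upTo m
    ... | js = right-eq js
    left-eq (j ∷ js) = cong (λ r → _ ∷ _ ∷ _ ∷ r) (left-eq js)

    right-eq : ∀ js → _ ≡ rightArrows js middles
    right-eq [] with upTo n
    ... | js = middle-eq js
    right-eq (j ∷ js) = cong (λ r → _ ∷ _ ∷ _ ∷ r) (right-eq js)

    middle-eq : ∀ js → _ ≡ middleArrows js []
    middle-eq []       = ≡.refl
    middle-eq (j ∷ js) = cong (_ ∷_) (middle-eq js)

  left-a→c : ∀ x i js r → Counts (leftArrows js r) (va x) (vc i)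
             (countIf (λ j → does ([ j ]ₗ ≟F x) ∧ does (α [ j ℕ.+ ℓ ∸ 1 ]ₗ ≟F i)) js) (count r (va x) (vc i))
  left-a→c x i []       r = counts ≡.refl
  left-a→c x i (j ∷ js) r = miss (λ ()) (hit (does-va [ j ]ₗ x) (does-vc (α [ j ℕ.+ ℓ ∸ 1 ]ₗ) i)
    (miss (λ ()) (left-a→c x i js r)))

  left-c→a : ∀ i x js r → Counts (leftArrows js r) (vc i) (va x)
             (countIf (λ j → does (α [ j ]ₗ ≟F i) ∧ does ([ j ]ₗ ≟F x)) js) (count r (vc i) (va x))
  left-c→a i x []       r = counts ≡.refl
  left-c→a i x (j ∷ js) r = miss (λ ()) (miss (λ ()) (hit (does-vc (α [ j ]ₗ) i) (does-va [ j ]ₗ x)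
    (left-c→a i x js r)))

  left-other : ∀ u v js r → (∀ x → va x ≢ u) → (∀ x → va x ≢ v) → Counts (leftArrows js r) u v 0 (count r u v)
  left-other u v []       r hu hv = counts ≡.refl
  left-other u v (j ∷ js) r hu hv = miss (hu _ ∘ proj₁) (miss (hu _ ∘ proj₁)
    (miss (hv _ ∘ proj₂) (left-other u v js r hu hv)))

  right-b→c : ∀ x i js r → Counts (rightArrows js r) (vb x) (vc i)
              (countIf (λ j → does ([ j ]ₘ ≟F x) ∧ does (β [ j ]ₘ ≟F i)) js) (count r (vb x) (vc i))
  right-b→c x i []       r = counts ≡.refl
  right-b→c x i (j ∷ js) r = miss (λ ()) (hit (does-vb [ j ]ₘ x) (does-vc (β [ j ]ₘ) i)
    (miss (λ ()) (right-b→c x i js r)))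

  right-c→b : ∀ i x js r → Counts (rightArrows js r) (vc i) (vb x)
              (countIf (λ j → does (β [ suc j ]ₘ ≟F i) ∧ does ([ j ]ₘ ≟F x)) js) (count r (vc i) (vb x))
  right-c→b i x []       r = counts ≡.refl
  right-c→b i x (j ∷ js) r = miss (λ ()) (miss (λ ()) (hit (does-vc (β [ suc j ]ₘ) i) (does-vb [ j ]ₘ x)
    (right-c→b i x js r)))

  right-other : ∀ u v js r → (∀ x → vb x ≢ u) → (∀ x → vb x ≢ v) → Counts (rightArrows js r) u v 0 (count r u v)
  right-other u v []       r hu hv = counts ≡.refl
  right-other u v (j ∷ js) r hu hv = miss (hu _ ∘ proj₁) (miss (hu _ ∘ proj₁)
    (miss (hv _ ∘ proj₂) (right-other u v js r hu hv)))

  middle-c→c : ∀ x i js r → Counts (middleArrows js r) (vc x) (vc i)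
               (countIf (λ j → does ([ j ]ₙ ≟F x) ∧ does ([ suc j ]ₙ ≟F i)) js) (count r (vc x) (vc i))
  middle-c→c x i []       r = counts ≡.refl
  middle-c→c x i (j ∷ js) r = hit (does-vc [ j ]ₙ x) (does-vc [ suc j ]ₙ i) (middle-c→c x i js r)

  middle-other : ∀ u v js → (∀ x → vc x ≢ u) ⊎ (∀ x → vc x ≢ v) → Counts (middleArrows js []) u v 0 0
  middle-other u v []       h = counts ≡.refl
  middle-other u v (j ∷ js) h = miss (λ (e , f) → [ (λ hu → hu _ e) , (λ hv → hv _ f) ]′ h) (middle-other u v js h)

  does-toℕ : ∀ {k} (i j : Fin k) → does (i ≟F j) ≡ does (toℕ i ℕ.≟ toℕ j)
  does-toℕ i j = does-⇔ (mk⇔ (cong toℕ) toℕ-injective) (i ≟F j) (toℕ i ℕ.≟ toℕ j)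

  count-a→c : ∀ x i → + count arrows (va x) (vc i) ≡ δ (toℕ (α [ toℕ x ℕ.+ ℓ ∸ 1 ]ₗ)) (toℕ i)
  count-a→c x i = cong +_ (begin
    count arrows (va x) (vc i)
      ≡⟨ cong (λ as → count as (va x) (vc i)) arrows-eq ⟩
    count (leftArrows (upTo ℓ) rights) (va x) (vc i)
      ≡⟨ total (left-a→c x i (upTo ℓ) rights) ⟩
    countIf (λ j → does ([ j ]ₗ ≟F x) ∧ does (α [ j ℕ.+ ℓ ∸ 1 ]ₗ ≟F i)) (upTo ℓ) ℕ.+ count rights (va x) (vc i)
      ≡⟨ cong₂ ℕ._+_ (countIf-mod x (λ j → does (α [ j ℕ.+ ℓ ∸ 1 ]ₗ ≟F i)))
           (≡.trans (total (right-other _ _ (upTo m) middles (λ _ ()) (λ _ ()))) (total (middle-other _ _ (upTo n) (inj₁ λ _ ())))) ⟩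
    indicator (does (α [ toℕ x ℕ.+ ℓ ∸ 1 ]ₗ ≟F i)) ℕ.+ 0
      ≡⟨ ℕP.+-identityʳ _ ⟩
    indicator (does (α [ toℕ x ℕ.+ ℓ ∸ 1 ]ₗ ≟F i))
      ≡⟨ cong indicator (does-toℕ (α [ toℕ x ℕ.+ ℓ ∸ 1 ]ₗ) i) ⟩
    indicator (does (toℕ (α [ toℕ x ℕ.+ ℓ ∸ 1 ]ₗ) ℕ.≟ toℕ i)) ∎)
    where open ≡-Reasoning

  count-c→a : ∀ i x → + count arrows (vc i) (va x) ≡ δ (toℕ (α x)) (toℕ i)
  count-c→a i x = cong +_ (begin
    count arrows (vc i) (va x)
      ≡⟨ cong (λ as → count as (vc i) (va x)) arrows-eq ⟩
    count (leftArrows (upTo ℓ) rights) (vc i) (va x)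
      ≡⟨ total (left-c→a i x (upTo ℓ) rights) ⟩
    countIf (λ j → does (α [ j ]ₗ ≟F i) ∧ does ([ j ]ₗ ≟F x)) (upTo ℓ) ℕ.+ count rights (vc i) (va x)
      ≡⟨ cong₂ ℕ._+_ (≡.trans (∧-comm-countIf (λ j → does (α [ j ]ₗ ≟F i)) (λ j → does ([ j ]ₗ ≟F x)) (upTo ℓ)) (countIf-mod x (λ j → does (α [ j ]ₗ ≟F i))))
           (≡.trans (total (right-other _ _ (upTo m) middles (λ _ ()) (λ _ ()))) (total (middle-other _ _ (upTo n) (inj₂ λ _ ())))) ⟩
    indicator (does (α [ toℕ x ]ₗ ≟F i)) ℕ.+ 0
      ≡⟨ ℕP.+-identityʳ _ ⟩
    indicator (does (α [ toℕ x ]ₗ ≟F i))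
      ≡⟨ cong indicator (does-toℕ (α [ toℕ x ]ₗ) i) ⟩
    indicator (does (toℕ (α [ toℕ x ]ₗ) ℕ.≟ toℕ i))
      ≡⟨ cong (λ j → indicator (does (toℕ (α j) ℕ.≟ toℕ i))) (mod-toℕ x) ⟩
    indicator (does (toℕ (α x) ℕ.≟ toℕ i)) ∎)
    where open ≡-Reasoning

  count-b→c : ∀ x i → + count arrows (vb x) (vc i) ≡ δ (toℕ (β x)) (toℕ i)
  count-b→c x i = cong +_ (begin
    count arrows (vb x) (vc i)
      ≡⟨ cong (λ as → count as (vb x) (vc i)) arrows-eq ⟩
    count (leftArrows (upTo ℓ) rights) (vb x) (vc i)
      ≡⟨ total (left-other _ _ (upTo ℓ) rights (λ _ ()) (λ _ ())) ⟩
    count rights (vb x) (vc i)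
      ≡⟨ total (right-b→c x i (upTo m) middles) ⟩
    countIf (λ j → does ([ j ]ₘ ≟F x) ∧ does (β [ j ]ₘ ≟F i)) (upTo m) ℕ.+ count middles (vb x) (vc i)
      ≡⟨ cong₂ ℕ._+_ (countIf-mod x (λ j → does (β [ j ]ₘ ≟F i))) (total (middle-other _ _ (upTo n) (inj₁ λ _ ()))) ⟩
    indicator (does (β [ toℕ x ]ₘ ≟F i)) ℕ.+ 0
      ≡⟨ ℕP.+-identityʳ _ ⟩
    indicator (does (β [ toℕ x ]ₘ ≟F i))
      ≡⟨ cong indicator (does-toℕ (β [ toℕ x ]ₘ) i) ⟩
    indicator (does (toℕ (β [ toℕ x ]ₘ) ℕ.≟ toℕ i))
      ≡⟨ cong (λ j → indicator (does (toℕ (β j) ℕ.≟ toℕ i))) (mod-toℕ x) ⟩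
    indicator (does (toℕ (β x) ℕ.≟ toℕ i)) ∎)
    where open ≡-Reasoning

  count-c→b : ∀ i x → + count arrows (vc i) (vb x) ≡ δ (toℕ (β [ suc (toℕ x) ]ₘ)) (toℕ i)
  count-c→b i x = cong +_ (begin
    count arrows (vc i) (vb x)
      ≡⟨ cong (λ as → count as (vc i) (vb x)) arrows-eq ⟩
    count (leftArrows (upTo ℓ) rights) (vc i) (vb x)
      ≡⟨ total (left-other _ _ (upTo ℓ) rights (λ _ ()) (λ _ ())) ⟩
    count rights (vc i) (vb x)
      ≡⟨ total (right-c→b i x (upTo m) middles) ⟩
    countIf (λ j → does (β [ suc j ]ₘ ≟F i) ∧ does ([ j ]ₘ ≟F x)) (upTo m) ℕ.+ count middles (vc i) (vb x)
      ≡⟨ cong₂ ℕ._+_ (≡.trans (∧-comm-countIf (λ j → does (β [ suc j ]ₘ ≟F i)) (λ j → does ([ j ]ₘ ≟F x)) (upTo m)) (countIf-mod x (λ j → does (β [ suc j ]ₘ ≟F i))))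
           (total (middle-other _ _ (upTo n) (inj₂ λ _ ()))) ⟩
    indicator (does (β [ suc (toℕ x) ]ₘ ≟F i)) ℕ.+ 0
      ≡⟨ ℕP.+-identityʳ _ ⟩
    indicator (does (β [ suc (toℕ x) ]ₘ ≟F i))
      ≡⟨ cong indicator (does-toℕ (β [ suc (toℕ x) ]ₘ) i) ⟩
    indicator (does (toℕ (β [ suc (toℕ x) ]ₘ) ℕ.≟ toℕ i)) ∎)
    where open ≡-Reasoning

  count-c→c : ∀ x i → + count arrows (vc x) (vc i) ≡ δ (toℕ [ suc (toℕ x) ]ₙ) (toℕ i)
  count-c→c x i = cong +_ (begin
    count arrows (vc x) (vc i)
      ≡⟨ cong (λ as → count as (vc x) (vc i)) arrows-eq ⟩
    count (leftArrows (upTo ℓ) rights) (vc x) (vc i)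
      ≡⟨ total (left-other _ _ (upTo ℓ) rights (λ _ ()) (λ _ ())) ⟩
    count rights (vc x) (vc i)
      ≡⟨ total (right-other _ _ (upTo m) middles (λ _ ()) (λ _ ())) ⟩
    count middles (vc x) (vc i)
      ≡⟨ total (middle-c→c x i (upTo n) []) ⟩
    countIf (λ j → does ([ j ]ₙ ≟F x) ∧ does ([ suc j ]ₙ ≟F i)) (upTo n) ℕ.+ 0
      ≡⟨ ℕP.+-identityʳ _ ⟩
    countIf (λ j → does ([ j ]ₙ ≟F x) ∧ does ([ suc j ]ₙ ≟F i)) (upTo n)
      ≡⟨ countIf-mod x (λ j → does ([ suc j ]ₙ ≟F i)) ⟩
    indicator (does ([ suc (toℕ x) ]ₙ ≟F i))
      ≡⟨ cong indicator (does-toℕ ([ suc (toℕ x) ]ₙ) i) ⟩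
    indicator (does (toℕ [ suc (toℕ x) ]ₙ ℕ.≟ toℕ i)) ∎)
    where open ≡-Reasoning

  -- The two positions in this row are the `p` and `j` in the definition of `a′`, and those in `Q-b`
  -- are the `j` and `q` of `b′`. Hence the row of an outer or inner face determines the factor by
  -- which T changes its weight.
  Q-a : ∀ x i → Q (va x) (vc i) ≡ δ (toℕ (α [ toℕ x ℕ.+ ℓ ∸ 1 ]ₗ)) (toℕ i) ℤ.- δ (toℕ (α x)) (toℕ i)
  Q-a x i = cong₂ ℤ._-_ (count-a→c x i) (count-c→a i x)

  Q-b : ∀ x i → Q (vb x) (vc i) ≡ δ (toℕ (β x)) (toℕ i) ℤ.- δ (toℕ (β [ suc (toℕ x) ]ₘ)) (toℕ i)
  Q-b x i = cong₂ ℤ._-_ (count-b→c x i) (count-c→b i x)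

  Q-c : ∀ x i → Q (vc x) (vc i) ≡ δ (toℕ [ suc (toℕ x) ]ₙ) (toℕ i) ℤ.- δ (toℕ [ suc (toℕ i) ]ₙ) (toℕ x)
  Q-c x i = cong₂ ℤ._-_ (count-c→c x i) (count-c→c i x)

-- The transformation T in terms of partial products

mod-+ : ∀ n ⦃ _ : NonZero n ⦄ i → (n ℕ.+ i) mod n ≡ i mod n
mod-+ n i = toℕ-injective (≡.trans (toℕ-fromℕ< (m%n<n (n ℕ.+ i) n))
  (≡.trans (≡.trans (cong (_% n) (ℕP.+-comm n i)) ([m+n]%n≡m%n i n)) (≡.sym (toℕ-fromℕ< (m%n<n i n)))))

module Blocks {c₁ ℓ₁ : Level} (S : Semifield c₁ ℓ₁) {K n : ℕ} ⦃ _ : NonZero n ⦄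
              (γ : Fin K → Fin n) (f : Fin K → Semifield.Carrier S) where
  open Semifield S renaming (_≈_ to infix 4 _≈_; _⁻¹ to infixl 8 _⁻¹)
  open YSeeds S renaming (_/_ to infixl 7 _/_)
  open SemifieldProperties S
  open import Relation.Binary.Reasoning.Setoid setoid

  block : ℕ → Carrier
  block s = prodF (λ r → f r when does (γ r ≟F (s mod n)))

  below : ℕ → Carrier
  below k = prodF (λ r → f r when does (toℕ (γ r) <? k))

  -- Each face belongs to the block of its associate. The bound on `k` is needed since `block` reads
  -- its index modulo `n` whereas `below` compares plain numbers.
  blocks-below : ∀ k → k ≤ n → prodR block 0 k ≈ below k
  blocks-below zero    _   = sym (prodF-1 K)
  blocks-below (suc k) k<n = begin
    prodR block 0 (suc k)          ≈⟨ prodR-suc block k ⟩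
    prodR block 0 k * block k      ≈⟨ *-congʳ (blocks-below k (ℕP.<⇒≤ k<n)) ⟩
    below k * block k              ≈⟨ prodF-* (λ r → f r when does (toℕ (γ r) <? k)) (λ r → f r when does (γ r ≟F (k mod n))) ⟨
    prodF (λ r → f r when does (toℕ (γ r) <? k) * f r when does (γ r ≟F (k mod n)))
                                   ≈⟨ prodF-cong pointwise ⟩
    below (suc k)                  ∎
    where
    pointwise : ∀ r → f r when does (toℕ (γ r) <? k) * f r when does (γ r ≟F (k mod n)) ≈ f r when does (toℕ (γ r) <? suc k)
    pointwise r with ℕP.<-cmp (toℕ (γ r)) k
    ... | tri< lt ne _ rewrite dec-true (toℕ (γ r) <? k) lt
                             | dec-false (γ r ≟F (k mod n)) (λ e → ne (≡.trans (cong toℕ e) (toℕ-mod n k<n)))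
                             | dec-true (toℕ (γ r) <? suc k) (ℕP.m<n⇒m<1+n lt) = identityʳ _
    ... | tri≈ nlt e _ rewrite dec-false (toℕ (γ r) <? k) nlt
                             | dec-true (γ r ≟F (k mod n)) (toℕ-injective (≡.trans e (≡.sym (toℕ-mod n k<n))))
                             | dec-true (toℕ (γ r) <? suc k) (ℕ.s≤s (ℕP.≤-reflexive e)) = identityˡ _
    ... | tri> nlt ne gt rewrite dec-false (toℕ (γ r) <? k) nlt
                             | dec-false (γ r ≟F (k mod n)) (λ e → ne (≡.trans (cong toℕ e) (toℕ-mod n k<n)))
                             | dec-false (toℕ (γ r) <? suc k) (λ lt → ℕP.<⇒≱ gt (ℕP.<⇒≤pred lt)) = identityʳ _

  blocks-all : prodR block 0 n ≈ prodF f
  blocks-all = trans (blocks-below n ℕP.≤-refl)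
    (prodF-cong λ r → reflexive (cong (f r when_) (dec-true (toℕ (γ r) <? n) (toℕ<n (γ r)))))

  blocks-≤ : ∀ (k : Fin n) → prodF (λ r → if does (toℕ (γ r) ≤? toℕ k) then f r else 1#) ≈ prodR block 0 (suc (toℕ k))
  blocks-≤ k = trans
    (prodF-cong λ r → reflexive (cong (f r when_)
      (does-⇔ (mk⇔ ℕ.s≤s ℕ.s≤s⁻¹) (toℕ (γ r) ≤? toℕ k) (toℕ (γ r) <? suc (toℕ k)))))
    (sym (blocks-below (suc (toℕ k)) (toℕ<n k)))

  -- For a strictly monotone association exactly one face lies between suitable neighbouring
  -- thresholds; its weight is then a quotient of two prefix products.
  blocks-add : ∀ {k k′} j → k ≤ n → k′ ≤ n → ¬ (toℕ (γ j) < k) → toℕ (γ j) < k′ →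
               (∀ i → i ≢ j → toℕ (γ i) < k ⇔ toℕ (γ i) < k′) →
               prodR block 0 k′ ≈ prodR block 0 k * f j
  blocks-add {k} {k′} j k≤n k′≤n ∉k ∈k′ others = begin
    prodR block 0 k′      ≈⟨ blocks-below k′ k′≤n ⟩
    below k′              ≈⟨ prodF-add f (λ i → does (toℕ (γ i) <? k)) (λ i → does (toℕ (γ i) <? k′)) j
                              (dec-false (toℕ (γ j) <? k) ∉k) (dec-true (toℕ (γ j) <? k′) ∈k′)
                              (λ i i≢j → does-⇔ (others i i≢j) (toℕ (γ i) <? k) (toℕ (γ i) <? k′)) ⟩
    below k * f j         ≈⟨ *-congʳ (blocks-below k k≤n) ⟨
    prodR block 0 k * f j ∎

cycle-length< : ∀ {p q} n ⦃ _ : NonZero n ⦄ → p < q → q < n → p ℕ.+ toℕ ((q ℕ.+ n ∸ p) mod n) ≡ q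
cycle-length< {p} {q} n p<q q<n = ≡.trans (cong (p ℕ.+_) length≡) (ℕP.m+[n∸m]≡n (ℕP.<⇒≤ p<q))
  where
  length≡ : toℕ ((q ℕ.+ n ∸ p) mod n) ≡ q ∸ p
  length≡ = ≡.trans (cong (λ i → toℕ (i mod n))
      (≡.trans (cong (_∸ p) (ℕP.+-comm q n)) (ℕP.+-∸-assoc n (ℕP.<⇒≤ p<q))))
    (≡.trans (cong toℕ (mod-+ n (q ∸ p))) (toℕ-mod n (ℕP.≤-<-trans (ℕP.m∸n≤m q p) q<n)))

-- The interval crosses the cut, so its end is represented by `n + q`. The product over a full turn
-- that this brings in is part of what becomes the factor `D` of a wrapped face.
cycle-length> : ∀ {p q} n ⦃ _ : NonZero n ⦄ → q < p → p < n → p ℕ.+ toℕ ((q ℕ.+ n ∸ p) mod n) ≡ n ℕ.+ q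
cycle-length> {p} {q} n q<p p<n = ≡.trans (cong (p ℕ.+_) (toℕ-mod n short))
    (≡.trans (ℕP.m+[n∸m]≡n p≤q+n) (ℕP.+-comm q n))
  where
  p≤q+n : p ≤ q ℕ.+ n
  p≤q+n = ℕP.≤-trans (ℕP.<⇒≤ p<n) (ℕP.m≤n+m n q)
  short : q ℕ.+ n ∸ p < n
  short = ℕP.+-cancelˡ-< p _ _ (≡.subst (ℕ._< p ℕ.+ n) (≡.sym (ℕP.m+[n∸m]≡n p≤q+n)) (ℕP.+-monoˡ-< n q<p))

module CyclicProducts {c₁ ℓ₁ : Level} (S : Semifield c₁ ℓ₁) (n′ : ℕ) (c : Fin (suc n′) → Semifield.Carrier S) where
  open Semifield S renaming (_≈_ to infix 4 _≈_; _⁻¹ to infixl 8 _⁻¹)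
  open YSeeds S renaming (_/_ to infixl 7 _/_)
  open SemifieldProperties S
  private n = suc n′

  P W : ℕ → Carrier
  P = prodR (λ s → c (s mod n)) 0
  W k = sumUpTo n′ (λ d → P (k ℕ.+ d))

  D : Carrier
  D = P n

  P-periodic : ∀ k → P (n ℕ.+ k) ≈ D * P k
  P-periodic = prodR-periodic (λ s → c (s mod n)) n (λ i → reflexive (cong c (mod-+ n i)))

  W-periodic : ∀ k → W (n ℕ.+ k) ≈ D * W k
  W-periodic k = trans
    (sumUpTo-cong n′ λ d → trans (reflexive (cong P (ℕP.+-assoc n k d))) (P-periodic (k ℕ.+ d)))
    (sym (sumUpTo-*ˡ n′ D (λ d → P (k ℕ.+ d))))

  -- T on the weight of an outer or inner face whose row in Q is e_p − e_q; the
  -- factor D appears when the face borders the cut between the last and the first c.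
  infix 4 _⟶_by_,_
  data _⟶_by_,_ (x x′ : Carrier) (p q : ℕ) : Set ℓ₁ where
    up   : p ≤ q → x′ ≈ x * (W (suc q) / W (suc p)) → x ⟶ x′ by p , q
    wrap : q < p → x′ ≈ x * (D * (W (suc q) / W (suc p))) → x ⟶ x′ by p , q

module Weights {c₁ ℓ₁ : Level} (S : Semifield c₁ ℓ₁) (n′ ℓ m : ℕ) ⦃ _ : NonZero ℓ ⦄ ⦃ _ : NonZero m ⦄
    (α : Fin ℓ → Fin (suc n′)) (β : Fin m → Fin (suc n′))
    (t : Semifield.Carrier S)
    (a : Fin ℓ → Semifield.Carrier S)
    (b : Fin m → Semifield.Carrier S)
    (c : Fin (suc n′) → Semifield.Carrier S)
    (total-weight : Semifield._≈_ S
        (Semifield._*_ S (Semifield._*_ S (YSeeds.prodF S a) (YSeeds.prodF S b)) (YSeeds.prodF S c))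
        (Semifield.1# S)) where
  open Semifield S renaming (_≈_ to infix 4 _≈_; _⁻¹ to infixl 8 _⁻¹)
  open YSeeds S renaming (_/_ to infixl 7 _/_)
  open SemifieldProperties S
  open import Relation.Binary.Reasoning.Setoid setoid
  open Network S (suc n′) ℓ m α β t a b c
  private
    n = suc n′
    module 𝔸 = Blocks S α a
    module 𝔹 = Blocks S β b
    module ℂ = Blocks S (id {A = Fin n}) c

  open CyclicProducts S n′ c public

  A V : ℕ → Carrier
  A = prodR PA 0
  V = prodR PB 0

  P-ℂ : ∀ k → P k ≈ prodR ℂ.block 0 k
  P-ℂ k = prodR-cong (λ i → sym (prodF-single c [ i ]ₙ)) 0 k

  A-periodic : ∀ k → A (n ℕ.+ k) ≈ A n * A k
  A-periodic = prodR-periodic PA n (λ i → reflexive (cong (λ j → prodF (λ r → a r when does (α r ≟F j))) (mod-+ n i)))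

  V-periodic : ∀ k → V (n ℕ.+ k) ≈ V n * V k
  V-periodic = prodR-periodic PB n (λ i → reflexive (cong (λ j → prodF (λ r → b r when does (β r ≟F j))) (mod-+ n i)))

  -- A full turn through all three circles has weight 1. So `A k * V k * P k` is periodic in `k`,
  -- although each of the three factors is multiplied by a constant after `n` steps.
  AVD : A n * V n * D ≈ 1#
  AVD = trans (*-cong (*-cong 𝔸.blocks-all 𝔹.blocks-all) (trans (P-ℂ n) ℂ.blocks-all)) total-weight

  Z-value : ∀ k → Z k ≈ t * A (suc (toℕ k)) * V (suc (toℕ k)) * P (suc (toℕ k))
  -- The test in `Z` reduces to this boolean. In the case `true` the edge is the one of the trail,
  -- of weight `t`; it fits the general formula because the other three factors make a full turn.
  Z-value k with toℕ k ℕ.≡ᵇ n′ in last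
  ... | true = begin
    t                                 ≈⟨ identityʳ t ⟨
    t * 1#                            ≈⟨ *-congˡ AVD ⟨
    t * (A n * V n * D)               ≈⟨ solve 4 (λ t a v p → t ⊕ (a ⊕ v ⊕ p) ⊜ t ⊕ a ⊕ v ⊕ p) ≡.refl (t ∷ A n ∷ V n ∷ D ∷ []) ⟩
    t * A n * V n * P n               ≡⟨ cong (λ j → t * A (suc j) * V (suc j) * P (suc j)) (ℕP.≡ᵇ⇒≡ (toℕ k) n′ (≡.subst T (≡.sym last) _)) ⟨
    t * A (suc (toℕ k)) * V (suc (toℕ k)) * P (suc (toℕ k)) ∎
  ... | false = *-cong (*-cong (*-congˡ (𝔸.blocks-≤ k)) (𝔹.blocks-≤ k))
                       (trans (ℂ.blocks-≤ k) (sym (P-ℂ (suc (toℕ k)))))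

  -- `λ̂` reads `z` at indices beyond `n`. The formula persists there because `A`, `V` and `P` gain
  -- together the factor of `AVD`.
  z-value : ∀ j → z j ≈ t * A (suc j) * V (suc j) * P (suc j)
  z-value j = trans (reflexive (cong z j≡)) (trans (by-periods (j div n) (j % n) (m%n<n j n))
    (reflexive (≡.sym (cong (λ j → t * A (suc j) * V (suc j) * P (suc j)) j≡))))
    where
    j≡ : j ≡ (j div n) ℕ.* n ℕ.+ j % n
    j≡ = ≡.trans (m≡m%n+[m/n]*n j n) (ℕP.+-comm (j % n) _)
    shifted : ∀ k → t * A (suc k) * V (suc k) * P (suc k) ≈ t * A (suc (n ℕ.+ k)) * V (suc (n ℕ.+ k)) * P (suc (n ℕ.+ k))
    shifted k = begin
      t * A (suc k) * V (suc k) * P (suc k)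
        ≈⟨ identityˡ _ ⟨
      1# * (t * A (suc k) * V (suc k) * P (suc k))
        ≈⟨ *-congʳ AVD ⟨
      (A n * V n * D) * (t * A (suc k) * V (suc k) * P (suc k))
        ≈⟨ solve 7 (λ a v p t a′ v′ p′ → (a ⊕ v ⊕ p) ⊕ (t ⊕ a′ ⊕ v′ ⊕ p′) ⊜ t ⊕ (a ⊕ a′) ⊕ (v ⊕ v′) ⊕ (p ⊕ p′)) ≡.refl
             (A n ∷ V n ∷ D ∷ t ∷ A (suc k) ∷ V (suc k) ∷ P (suc k) ∷ []) ⟩
      t * (A n * A (suc k)) * (V n * V (suc k)) * (D * P (suc k))
        ≈⟨ *-cong (*-cong (*-congˡ (A-periodic (suc k))) (V-periodic (suc k))) (P-periodic (suc k)) ⟨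
      t * A (n ℕ.+ suc k) * V (n ℕ.+ suc k) * P (n ℕ.+ suc k)
        ≡⟨ cong (λ j → t * A j * V j * P j) (ℕP.+-suc n k) ⟩
      t * A (suc (n ℕ.+ k)) * V (suc (n ℕ.+ k)) * P (suc (n ℕ.+ k)) ∎
    by-periods : ∀ q r → r < n → z (q ℕ.* n ℕ.+ r) ≈
      t * A (suc (q ℕ.* n ℕ.+ r)) * V (suc (q ℕ.* n ℕ.+ r)) * P (suc (q ℕ.* n ℕ.+ r))
    by-periods zero r r<n = trans (Z-value [ r ]ₙ)
      (reflexive (cong (λ j → t * A (suc j) * V (suc j) * P (suc j)) (toℕ-mod n r<n)))
    by-periods (suc q) r r<n = begin
      z (n ℕ.+ q ℕ.* n ℕ.+ r)   ≡⟨ cong z (ℕP.+-assoc n (q ℕ.* n) r) ⟩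
      z (n ℕ.+ (q ℕ.* n ℕ.+ r)) ≡⟨ cong Z (mod-+ n (q ℕ.* n ℕ.+ r)) ⟩
      z (q ℕ.* n ℕ.+ r)         ≈⟨ by-periods q r r<n ⟩
      _                         ≈⟨ shifted (q ℕ.* n ℕ.+ r) ⟩
      _                         ≡⟨ cong (λ j → t * A (suc j) * V (suc j) * P (suc j)) (ℕP.+-assoc n (q ℕ.* n) r) ⟨
      _                         ∎

  x-value : ∀ k → x k ≈ PA k ⁻¹
  x-value k = trans (prodF-cong pointwise) (prodF-⁻¹ (λ r → a r when does (α r ≟F [ k ]ₙ)))
    where
    pointwise : ∀ j → (if does (α j ≟F [ k ]ₙ) then a j ⁻¹ else 1#) ≈ (a j when does (α j ≟F [ k ]ₙ)) ⁻¹
    pointwise j with does (α j ≟F [ k ]ₙ)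
    ... | true  = refl
    ... | false = solve 0 (zero ⊜ neg zero) ≡.refl []

  -- In the summand for `d` the crossing weight contributes `A` and `V` at `suc (i + d)`. The
  -- product of `x` is an inverse ratio of values of `A`, that of `y` a ratio of values of `V`, and
  -- they cancel both. Apart from `P`, what is left does not depend on `d`, and the remaining sum is
  -- `W`.
  λ̂-value : ∀ i → λ̂ i ≈ (t * V n * V i * A (suc i)) * W (suc i)
  λ̂-value i = trans (sumUpTo-cong≤ n′ term) (sym (sumUpTo-*ˡ n′ (t * V n * V i * A (suc i)) (λ d → P (suc i ℕ.+ d))))
    where
    term : ∀ d → d ≤ n′ → prodR x (suc i) d * z (i ℕ.+ d) * prodR y (suc (i ℕ.+ d)) (n′ ∸ d) ≈
           (t * V n * V i * A (suc i)) * P (suc i ℕ.+ d)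
    term d d≤n′ = begin
      prodR x (suc i) d * z (i ℕ.+ d) * prodR y (suc (i ℕ.+ d)) (n′ ∸ d)
        ≈⟨ *-cong (*-cong x-part (z-value (i ℕ.+ d))) y-part ⟩
      (A (suc j) / A (suc i)) ⁻¹ * (t * A (suc j) * V (suc j) * P (suc j)) * (V n * V i / V (suc j))
        ≈⟨ solve 7 (λ aj ai t vj pj vn vi → neg (aj ⊖ ai) ⊕ (t ⊕ aj ⊕ vj ⊕ pj) ⊕ ((vn ⊕ vi) ⊖ vj)
                      ⊜ (t ⊕ vn ⊕ vi ⊕ ai) ⊕ pj) ≡.refl
             (A (suc j) ∷ A (suc i) ∷ t ∷ V (suc j) ∷ P (suc j) ∷ V n ∷ V i ∷ []) ⟩
      (t * V n * V i * A (suc i)) * P (suc i ℕ.+ d) ∎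
      where
      j = i ℕ.+ d
      x-part : prodR x (suc i) d ≈ (A (suc j) / A (suc i)) ⁻¹
      x-part = trans (prodR-cong x-value (suc i) d)
        (trans (prodR-⁻¹ PA (suc i) d) (⁻¹-cong (prodR-quotient PA (suc i) d)))
      end : suc j ℕ.+ (n′ ∸ d) ≡ n ℕ.+ i
      end = cong suc (≡.trans (ℕP.+-assoc i d (n′ ∸ d))
        (≡.trans (cong (i ℕ.+_) (ℕP.m+[n∸m]≡n d≤n′)) (ℕP.+-comm i n′)))
      y-part : prodR y (suc j) (n′ ∸ d) ≈ V n * V i / V (suc j)
      y-part = trans (prodR-quotient PB (suc j) (n′ ∸ d))
        (*-congʳ (trans (reflexive (cong V end)) (V-periodic i)))

  c′-value : ∀ i → c′ i ≈ c i * (W (toℕ i) / W (2 ℕ.+ toℕ i))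
  c′-value i = begin
    (c i * λ̂ h * prodR PA k 2 * prodR PB h 2) / λ̂ (suc k)
      ≈⟨ *-cong (*-cong (*-cong (*-congˡ (λ̂-value h)) (prodR-quotient PA k 2)) (prodR-quotient PB h 2))
                (⁻¹-cong (λ̂-value (suc k))) ⟩
    (c i * (t * V n * V h * A (suc h) * W (suc h)) * (A (k ℕ.+ 2) / A k) * (V (h ℕ.+ 2) / V h))
      / (t * V n * V (suc k) * A (2 ℕ.+ k) * W (2 ℕ.+ k))
      ≈⟨ *-cong (*-cong (*-cong (*-congˡ (*-cong (*-congˡ A-h) W-h)) (*-congʳ (reflexive (cong A (ℕP.+-comm k 2)))))
                        (*-congʳ V-h)) refl ⟩
    (c i * (t * V n * V h * (A n * A k) * (D * W k)) * (A (2 ℕ.+ k) / A k) * (V n * V (suc k) / V h))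
      / (t * V n * V (suc k) * A (2 ℕ.+ k) * W (2 ℕ.+ k))
      ≈⟨ solve 11 (λ c t vn vh an ak d wk ak2 vk wk2 →
            (c ⊕ (t ⊕ vn ⊕ vh ⊕ (an ⊕ ak) ⊕ (d ⊕ wk)) ⊕ (ak2 ⊖ ak) ⊕ ((vn ⊕ vk) ⊖ vh)) ⊖ (t ⊕ vn ⊕ vk ⊕ ak2 ⊕ wk2)
            ⊜ (an ⊕ vn ⊕ d) ⊕ (c ⊕ (wk ⊖ wk2))) ≡.refl
           (c i ∷ t ∷ V n ∷ V h ∷ A n ∷ A k ∷ D ∷ W k ∷ A (2 ℕ.+ k) ∷ V (suc k) ∷ W (2 ℕ.+ k) ∷ []) ⟩
    (A n * V n * D) * (c i * (W k / W (2 ℕ.+ k)))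
      ≈⟨ trans (*-congʳ AVD) (identityˡ _) ⟩
    c i * (W k / W (2 ℕ.+ k)) ∎
    where
    k = toℕ i
    -- The predecessor of `k` on the circle, kept nonnegative by adding `n`. The shift costs `A n`,
    -- `V n` and `D`, once each, and these cancel by `AVD`.
    h = k ℕ.+ n ∸ 1
    h≡ : h ≡ k ℕ.+ n′
    h≡ = ℕP.+-∸-assoc k {n} {1} (ℕ.s≤s ℕ.z≤n)
    suc-h : suc h ≡ n ℕ.+ k
    suc-h = cong suc (≡.trans h≡ (ℕP.+-comm k n′))
    A-h : A (suc h) ≈ A n * A k
    A-h = trans (reflexive (cong A suc-h)) (A-periodic k)
    W-h : W (suc h) ≈ D * W k
    W-h = trans (reflexive (cong W suc-h)) (W-periodic k)
    V-h : V (h ℕ.+ 2) ≈ V n * V (suc k)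
    V-h = trans (reflexive (cong V (≡.trans (ℕP.+-comm h 2) (≡.trans (cong suc suc-h) (≡.sym (ℕP.+-suc n k))))))
                (V-periodic (suc k))

  -- An `a`-face is associated to the end `q` of its row, a `b`-face to the end `p`. Therefore the
  -- weight is read off from prefixes that include the ends for `A`, but from prefixes that exclude
  -- them for `V` in `right-face<`.
  left-face< : ∀ {p q} x → p < q → q < n → A (suc q) ≈ A (suc p) * x →
              x ⟶ λ̂ q / (λ̂ p * prodR PB p (cycLen p q)) by p , q
  left-face< {p} {q} x p<q q<n A-eq = up (ℕP.<⇒≤ p<q) (begin
    λ̂ q / (λ̂ p * prodR PB p (cycLen p q))
      ≈⟨ *-cong (λ̂-value q) (⁻¹-cong (*-cong (λ̂-value p) (trans (prodR-quotient PB p (cycLen p q))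
           (*-congʳ (reflexive (cong V (cycle-length< n p<q q<n))))))) ⟩
    (t * V n * V q * A (suc q) * W (suc q)) / (t * V n * V p * A (suc p) * W (suc p) * (V q / V p))
      ≈⟨ *-congʳ (*-congʳ (*-congˡ A-eq)) ⟩
    (t * V n * V q * (A (suc p) * x) * W (suc q)) / (t * V n * V p * A (suc p) * W (suc p) * (V q / V p))
      ≈⟨ solve 8 (λ t vn vq ap x wq vp wp →
           (t ⊕ vn ⊕ vq ⊕ (ap ⊕ x) ⊕ wq) ⊖ (t ⊕ vn ⊕ vp ⊕ ap ⊕ wp ⊕ (vq ⊖ vp)) ⊜ x ⊕ (wq ⊖ wp)) ≡.refl
           (t ∷ V n ∷ V q ∷ A (suc p) ∷ x ∷ W (suc q) ∷ V p ∷ W (suc p) ∷ []) ⟩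
    x * (W (suc q) / W (suc p)) ∎)

  left-face> : ∀ {p q} x → q < p → p < n → A (suc q) ≈ x → A (suc p) ≈ A n →
              x ⟶ λ̂ q / (λ̂ p * prodR PB p (cycLen p q)) by p , q
  left-face> {p} {q} x q<p p<n A-q A-p = wrap q<p (begin
    λ̂ q / (λ̂ p * prodR PB p (cycLen p q))
      ≈⟨ *-cong (λ̂-value q) (⁻¹-cong (*-cong (λ̂-value p) (trans (prodR-quotient PB p (cycLen p q))
           (*-congʳ (trans (reflexive (cong V (cycle-length> n q<p p<n))) (V-periodic q)))))) ⟩
    (t * V n * V q * A (suc q) * W (suc q)) / (t * V n * V p * A (suc p) * W (suc p) * (V n * V q / V p))
      ≈⟨ *-cong (*-congʳ (*-congˡ A-q)) (⁻¹-cong (*-congʳ (*-congʳ (*-congˡ A-p)))) ⟩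
    (t * V n * V q * x * W (suc q)) / (t * V n * V p * A n * W (suc p) * (V n * V q / V p))
      -- The surplus `A n * V n` in the denominator is completed by `D` to a full turn, and this
      -- leaves a `D` in the numerator.
      ≈⟨ solve 9 (λ t vn vq an x wq vp wp d →
           (t ⊕ vn ⊕ vq ⊕ x ⊕ wq) ⊖ (t ⊕ vn ⊕ vp ⊕ an ⊕ wp ⊕ ((vn ⊕ vq) ⊖ vp))
           ⊜ neg (an ⊕ vn ⊕ d) ⊕ (x ⊕ (d ⊕ (wq ⊖ wp)))) ≡.refl
           (t ∷ V n ∷ V q ∷ A n ∷ x ∷ W (suc q) ∷ V p ∷ W (suc p) ∷ D ∷ []) ⟩
    (A n * V n * D) ⁻¹ * (x * (D * (W (suc q) / W (suc p))))
      ≈⟨ *-congʳ (trans (⁻¹-cong AVD) (solve 0 (neg zero ⊜ zero) ≡.refl [])) ⟩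
    1# * (x * (D * (W (suc q) / W (suc p))))
      ≈⟨ identityˡ _ ⟩
    x * (D * (W (suc q) / W (suc p))) ∎)

  right-face< : ∀ {p q} x → p < q → q < n → V q ≈ V p * x →
              x ⟶ λ̂ q / (λ̂ p * prodR PA (suc p) (cycLen p q)) by p , q
  right-face< {p} {q} x p<q q<n V-eq = up (ℕP.<⇒≤ p<q) (begin
    λ̂ q / (λ̂ p * prodR PA (suc p) (cycLen p q))
      ≈⟨ *-cong (λ̂-value q) (⁻¹-cong (*-cong (λ̂-value p) (trans (prodR-quotient PA (suc p) (cycLen p q))
           (*-congʳ (reflexive (cong (A ∘ suc) (cycle-length< n p<q q<n))))))) ⟩
    (t * V n * V q * A (suc q) * W (suc q)) / (t * V n * V p * A (suc p) * W (suc p) * (A (suc q) / A (suc p)))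
      ≈⟨ *-congʳ (*-congʳ (*-congʳ (*-congˡ V-eq))) ⟩
    (t * V n * (V p * x) * A (suc q) * W (suc q)) / (t * V n * V p * A (suc p) * W (suc p) * (A (suc q) / A (suc p)))
      ≈⟨ solve 8 (λ t vn vp x aq wq ap wp →
           (t ⊕ vn ⊕ (vp ⊕ x) ⊕ aq ⊕ wq) ⊖ (t ⊕ vn ⊕ vp ⊕ ap ⊕ wp ⊕ (aq ⊖ ap)) ⊜ x ⊕ (wq ⊖ wp)) ≡.refl
           (t ∷ V n ∷ V p ∷ x ∷ A (suc q) ∷ W (suc q) ∷ A (suc p) ∷ W (suc p) ∷ []) ⟩
    x * (W (suc q) / W (suc p)) ∎)

  right-face> : ∀ {p q} x → q < p → p < n → V q ≈ 1# → V n ≈ V p * x →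
              x ⟶ λ̂ q / (λ̂ p * prodR PA (suc p) (cycLen p q)) by p , q
  right-face> {p} {q} x q<p p<n V-q V-p = wrap q<p (begin
    λ̂ q / (λ̂ p * prodR PA (suc p) (cycLen p q))
      ≈⟨ *-cong (λ̂-value q) (⁻¹-cong (*-cong (λ̂-value p) (trans (prodR-quotient PA (suc p) (cycLen p q))
           (*-congʳ (trans (reflexive (cong A (≡.trans (cong suc (cycle-length> n q<p p<n)) (≡.sym (ℕP.+-suc n q)))))
                           (A-periodic (suc q))))))) ⟩
    (t * V n * V q * A (suc q) * W (suc q)) / (t * V n * V p * A (suc p) * W (suc p) * (A n * A (suc q) / A (suc p)))
      ≈⟨ *-congʳ (*-congʳ (*-congʳ (*-cong (*-congˡ V-p) V-q))) ⟩
    (t * (V p * x) * 1# * A (suc q) * W (suc q)) / (t * V n * V p * A (suc p) * W (suc p) * (A n * A (suc q) / A (suc p)))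
      ≈⟨ solve 10 (λ t vn vp an x aq wq ap wp d →
           (t ⊕ (vp ⊕ x) ⊕ zero ⊕ aq ⊕ wq) ⊖ (t ⊕ vn ⊕ vp ⊕ ap ⊕ wp ⊕ ((an ⊕ aq) ⊖ ap))
           ⊜ neg (an ⊕ vn ⊕ d) ⊕ (x ⊕ (d ⊕ (wq ⊖ wp)))) ≡.refl
           (t ∷ V n ∷ V p ∷ A n ∷ x ∷ A (suc q) ∷ W (suc q) ∷ A (suc p) ∷ W (suc p) ∷ D ∷ []) ⟩
    (A n * V n * D) ⁻¹ * (x * (D * (W (suc q) / W (suc p))))
      ≈⟨ *-congʳ (trans (⁻¹-cong AVD) (solve 0 (neg zero ⊜ zero) ≡.refl [])) ⟩
    1# * (x * (D * (W (suc q) / W (suc p))))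
      ≈⟨ identityˡ _ ⟩
    x * (D * (W (suc q) / W (suc p))) ∎)

-- T on outer and inner faces with strictly increasing associations

module StrictlyMonotone {K n : ℕ} (γ : Fin K → Fin n) (γ-mono : ∀ i j → i Fin.< j → γ i Fin.< γ j) where

  mono-≤ : ∀ {i j} → i Fin.≤ j → γ i Fin.≤ γ j
  mono-≤ {i} {j} i≤j with ℕP.m≤n⇒m<n∨m≡n i≤j
  ... | inj₁ i<j = ℕP.<⇒≤ (γ-mono i j i<j)
  ... | inj₂ i≡j = ℕP.≤-reflexive (cong (toℕ ∘ γ) (toℕ-injective i≡j))

  cancel-< : ∀ {i j} → γ i Fin.< γ j → i Fin.< j
  cancel-< γi<γj = ℕP.≰⇒> (λ j≤i → ℕP.<⇒≱ γi<γj (mono-≤ j≤i))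

  cancel-≤ : ∀ {i j} → γ i Fin.≤ γ j → i Fin.≤ j
  cancel-≤ {i} {j} γi≤γj = ℕP.≮⇒≥ (λ j<i → ℕP.<⇒≱ (γ-mono j i j<i) γi≤γj)

  ≤∧≢⇒< : ∀ {i j : Fin K} → i Fin.≤ j → i ≢ j → i Fin.< j
  ≤∧≢⇒< i≤j i≢j = ℕP.≤∧≢⇒< i≤j (i≢j ∘ toℕ-injective)

module MonotoneWeights {c₁ ℓ₁ : Level} (S : Semifield c₁ ℓ₁) (n′ ℓ m : ℕ) ⦃ _ : NonZero ℓ ⦄ ⦃ _ : NonZero m ⦄
    (2≤ℓ : 2 ≤ ℓ) (2≤m : 2 ≤ m)
    (α : Fin ℓ → Fin (suc n′)) (β : Fin m → Fin (suc n′))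
    (α-mono : ∀ i j → i Fin.< j → α i Fin.< α j)
    (α-last : ∀ j → suc (toℕ j) ≡ ℓ → suc (toℕ (α j)) ≡ suc n′)
    (β-mono : ∀ i j → i Fin.< j → β i Fin.< β j)
    (β-first : ∀ j → toℕ j ≡ 0 → toℕ (β j) ≡ 0)
    (t : Semifield.Carrier S)
    (a : Fin ℓ → Semifield.Carrier S)
    (b : Fin m → Semifield.Carrier S)
    (c : Fin (suc n′) → Semifield.Carrier S)
    (total-weight : Semifield._≈_ S
        (Semifield._*_ S (Semifield._*_ S (YSeeds.prodF S a) (YSeeds.prodF S b)) (YSeeds.prodF S c))
        (Semifield.1# S)) where
  open Semifield S renaming (_≈_ to infix 4 _≈_; _⁻¹ to infixl 8 _⁻¹)
  open SemifieldProperties S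
  open Network S (suc n′) ℓ m α β t a b c
  open Weights S n′ ℓ m α β t a b c total-weight public
  private
    n = suc n′
    module Mα = StrictlyMonotone α α-mono
    module Mβ = StrictlyMonotone β β-mono

  a′-value : ∀ i → a i ⟶ a′ i by toℕ (α [ toℕ i ℕ.+ ℓ ∸ 1 ]ₗ) , toℕ (α i)
  a′-value i = by-index (toℕ i) ≡.refl
    where
    j = [ toℕ i ℕ.+ ℓ ∸ 1 ]ₗ
    1≤ℓ : 1 ≤ ℓ
    1≤ℓ = ℕP.<⇒≤ 2≤ℓ
    by-index : ∀ k → toℕ i ≡ k → a i ⟶ a′ i by toℕ (α j) , toℕ (α i)
    -- The one wrapped face of this circle: its cyclic predecessor is the last face, which `α-last`
    -- associates to the last middle face. The two faces are distinct since `2 ≤ ℓ`.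
    by-index zero i≡0 = left-face> (a i) (α-mono i j i<j) (toℕ<n (α j)) A-first
      (reflexive (cong A (α-last j (≡.trans (cong suc j≡) (ℕP.m+[n∸m]≡n 1≤ℓ)))))
      where
      j≡ : toℕ j ≡ ℓ ∸ 1
      j≡ = ≡.trans (cong (λ k → toℕ [ k ℕ.+ ℓ ∸ 1 ]ₗ) i≡0)
                   (toℕ-mod ℓ (ℕP.≤-reflexive (ℕP.m+[n∸m]≡n 1≤ℓ)))
      i<j : i Fin.< j
      i<j = ≡.subst₂ _<_ (≡.sym i≡0) (≡.sym j≡) (ℕP.m<n⇒0<n∸m 2≤ℓ)
      A-first : A (suc (toℕ (α i))) ≈ a i
      A-first = trans (Blocks.blocks-add S α a {0} i ℕ.z≤n (toℕ<n (α i)) (λ ()) ℕP.≤-refl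
        λ i′ i′≢i → mk⇔ (λ ()) λ i′≤i → contradiction
          (≡.subst (toℕ i′ <_) i≡0 (Mα.≤∧≢⇒< (Mα.cancel-≤ (ℕ.s≤s⁻¹ i′≤i)) i′≢i)) λ ())
        (identityˡ _)
    by-index (suc k) i≡1+k = left-face< (a i) (α-mono j i j<i) (toℕ<n (α i)) A-next
      where
      j≡ : toℕ j ≡ k
      j≡ = ≡.trans (cong (λ k → toℕ [ k ℕ.+ ℓ ∸ 1 ]ₗ) i≡1+k)
        (≡.trans (cong (λ k → toℕ [ k ]ₗ) (ℕP.+-comm k ℓ))
        (≡.trans (cong toℕ (mod-+ ℓ k)) (toℕ-mod ℓ (ℕP.<⇒≤ (≡.subst (_< ℓ) i≡1+k (toℕ<n i))))))
      i≡1+j : toℕ i ≡ suc (toℕ j)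
      i≡1+j = ≡.trans i≡1+k (cong suc (≡.sym j≡))
      j<i : j Fin.< i
      j<i = ℕP.≤-reflexive (≡.sym i≡1+j)
      A-next : A (suc (toℕ (α i))) ≈ A (suc (toℕ (α j))) * a i
      A-next = Blocks.blocks-add S α a i (toℕ<n (α j)) (toℕ<n (α i))
        (λ αi≤αj → ℕP.<⇒≱ (α-mono j i j<i) (ℕ.s≤s⁻¹ αi≤αj)) ℕP.≤-refl
        λ i′ i′≢i → mk⇔
          (λ i′≤j → ℕ.s≤s (ℕP.≤-trans (ℕ.s≤s⁻¹ i′≤j) (Mα.mono-≤ (ℕP.<⇒≤ j<i))))
          (λ i′≤i → ℕ.s≤s (Mα.mono-≤ (ℕ.s≤s⁻¹ (≡.subst (toℕ i′ <_) i≡1+j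
                      (Mα.≤∧≢⇒< (Mα.cancel-≤ (ℕ.s≤s⁻¹ i′≤i)) i′≢i)))))

  b′-value : ∀ i → b i ⟶ b′ i by toℕ (β i) , toℕ (β [ suc (toℕ i) ]ₘ)
  b′-value i = by-index (ℕP.m≤n⇒m<n∨m≡n (toℕ<n i))
    where
    j = [ suc (toℕ i) ]ₘ
    by-index : suc (toℕ i) < m ⊎ suc (toℕ i) ≡ m → b i ⟶ b′ i by toℕ (β i) , toℕ (β j)
    by-index (inj₁ 1+i<m) = right-face< (b i) (β-mono i j i<j) (toℕ<n (β j)) V-next
      where
      j≡1+i : toℕ j ≡ suc (toℕ i)
      j≡1+i = toℕ-mod m 1+i<m
      i<j : i Fin.< j
      i<j = ℕP.≤-reflexive (≡.sym j≡1+i)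
      V-next : V (toℕ (β j)) ≈ V (toℕ (β i)) * b i
      V-next = Blocks.blocks-add S β b i (ℕP.<⇒≤ (toℕ<n (β i))) (ℕP.<⇒≤ (toℕ<n (β j)))
        (ℕP.<-irrefl ≡.refl) (β-mono i j i<j)
        λ i′ i′≢i → mk⇔ (λ i′<i → ℕP.<-trans i′<i (β-mono i j i<j))
          (λ i′<j → β-mono i′ i (Mβ.≤∧≢⇒< (ℕ.s≤s⁻¹ (≡.subst (toℕ i′ <_) j≡1+i (Mβ.cancel-< i′<j))) i′≢i))
    -- Here it is the last face that wraps: its successor is the face of index 0, associated to 0 by
    -- `β-first`, so that no block precedes it.
    by-index (inj₂ 1+i≡m) = right-face> (b i) (β-mono j i j<i) (toℕ<n (β i))
      (reflexive (cong V (β-first j j≡0))) V-last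
      where
      j≡0 : toℕ j ≡ 0
      j≡0 = ≡.trans (cong (λ k → toℕ [ k ]ₘ) (≡.trans 1+i≡m (≡.sym (ℕP.+-identityʳ m))))
        (≡.trans (cong toℕ (mod-+ m 0)) (toℕ-mod m (ℕP.<⇒≤ 2≤m)))
      j<i : j Fin.< i
      j<i = ≡.subst (_< toℕ i) (≡.sym j≡0) (ℕ.s≤s⁻¹ (≡.subst (2 ≤_) (≡.sym 1+i≡m) 2≤m))
      V-last : V n ≈ V (toℕ (β i)) * b i
      V-last = Blocks.blocks-add S β b i (ℕP.<⇒≤ (toℕ<n (β i))) ℕP.≤-refl
        (ℕP.<-irrefl ≡.refl) (toℕ<n (β i))
        λ i′ i′≢i → mk⇔ (λ _ → toℕ<n (β i′))
          (λ _ → β-mono i′ i (Mβ.≤∧≢⇒< (ℕ.s≤s⁻¹ (≡.subst (toℕ i′ <_) (≡.sym 1+i≡m) (toℕ<n i′))) i′≢i))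

-- The mutations before the last two vertices

δ-same : ∀ p → δ p p ≡ + 1
δ-same p = cong (λ d → + (if d then 1 else 0)) (dec-true (p ℕ.≟ p) ≡.refl)

δ-diff : ∀ {p i} → p ≢ i → δ p i ≡ + 0
δ-diff {p} {i} p≢i = cong (λ d → + (if d then 1 else 0)) (dec-false (p ℕ.≟ i) p≢i)

module Forward {c₁ ℓ₁ : Level} (S : Semifield c₁ ℓ₁) (N ℓ m : ℕ)
               (c : Fin (2 ℕ.+ N) → Semifield.Carrier S) where
  open Semifield S renaming (_≈_ to infix 4 _≈_; _⁻¹ to infixl 8 _⁻¹)
  open YSeeds S renaming (_/_ to infixl 7 _/_)
  open SemifieldProperties S
  open Seeds S {ℓ} {m} {2 ℕ.+ N}
  open CyclicProducts S (suc N) c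
  open import Relation.Binary.Reasoning.Setoid setoid

  n = 2 ℕ.+ N

  ΣP : ℕ → Carrier
  ΣP k = sumUpTo k P

  C : ℕ → Vtx ℓ m n
  C k = vc (k mod n)

  -- Splits the `n` consecutive partial products at the cut: the last `suc k` of them have index at
  -- least `n`, and quasi-periodicity turns these into `D * P i` with `i ≤ k`.
  W-head : ∀ k e → k ℕ.+ suc e ≡ suc N → W (suc k) ≈ sumUpTo e (λ d → P (suc k ℕ.+ d)) + D * ΣP k
  W-head k e eq = begin
    W (suc k)
      ≡⟨ cong (λ j → sumUpTo j (λ d → P (suc k ℕ.+ d))) eq ⟨
    sumUpTo (k ℕ.+ suc e) (λ d → P (suc k ℕ.+ d))
      ≈⟨ sumUpTo-split e k _ ⟩
    sumUpTo e (λ d → P (suc k ℕ.+ d)) + sumUpTo k (λ i → P (suc k ℕ.+ (i ℕ.+ suc e)))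
      ≈⟨ +-congˡ (sumUpTo-cong k λ i → trans (reflexive (cong P (shift i))) (P-periodic i)) ⟩
    sumUpTo e (λ d → P (suc k ℕ.+ d)) + sumUpTo k (λ i → D * P i)
      ≈⟨ +-congˡ (sumUpTo-*ˡ k D P) ⟨
    sumUpTo e (λ d → P (suc k ℕ.+ d)) + D * ΣP k ∎
    where
    shift : ∀ i → suc k ℕ.+ (i ℕ.+ suc e) ≡ n ℕ.+ i
    shift i = cong suc (≡.trans (cong (k ℕ.+_) (ℕP.+-comm i (suc e)))
      (≡.trans (≡.sym (ℕP.+-assoc k (suc e) i)) (cong (ℕ._+ i) eq)))

  W-zero : ∀ k e → k ℕ.+ suc e ≡ suc N → W 0 ≈ ΣP k + sumUpTo e (λ d → P (suc k ℕ.+ d))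
  W-zero k e eq = begin
    sumUpTo (suc N) P
      ≡⟨ cong (λ j → sumUpTo j P) (≡.trans (ℕP.+-comm e (suc k)) (≡.trans (≡.sym (ℕP.+-suc k e)) eq)) ⟨
    sumUpTo (e ℕ.+ suc k) P
      ≈⟨ sumUpTo-split k e P ⟩
    ΣP k + sumUpTo e (λ d → P (d ℕ.+ suc k))
      ≈⟨ +-congˡ (sumUpTo-cong e λ d → reflexive (cong P (ℕP.+-comm d (suc k)))) ⟩
    ΣP k + sumUpTo e (λ d → P (suc k ℕ.+ d)) ∎

  tail-peel : ∀ k e → sumUpTo (suc e) (λ d → P (k ℕ.+ d)) ≈ P k + sumUpTo e (λ d → P (suc k ℕ.+ d))
  tail-peel k e = begin
    sumUpTo (suc e) (λ d → P (k ℕ.+ d))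
      ≡⟨ cong (λ j → sumUpTo j (λ d → P (k ℕ.+ d))) (ℕP.+-comm 1 e) ⟩
    sumUpTo (e ℕ.+ 1) (λ d → P (k ℕ.+ d))
      ≈⟨ sumUpTo-split 0 e _ ⟩
    P (k ℕ.+ 0) + sumUpTo e (λ d → P (k ℕ.+ (d ℕ.+ 1)))
      ≈⟨ +-cong (reflexive (cong P (ℕP.+-identityʳ k)))
                (sumUpTo-cong e λ d → reflexive (cong P (≡.trans (cong (k ℕ.+_) (ℕP.+-comm d 1)) (ℕP.+-suc k d)))) ⟩
    P k + sumUpTo e (λ d → P (suc k ℕ.+ d)) ∎

  -- Read `s` as `ΣP k`, `p` as `P (suc k)`, `u` as the sum of the partial products of index `2 + k`
  -- to `n - 1`, and `d` as `D`. The brackets on the left are then `W (2 + k)` and `W 0`, the last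
  -- one on the right is `W (suc k)`.
  expand : ∀ s p u d → s * (u + d * (s + p)) + p * ((s + p) + u) ≈ (s + p) * ((p + u) + d * s)
  expand s p u d = begin
    s * (u + d * (s + p)) + p * ((s + p) + u)
      ≈⟨ +-cong (distribˡ s u _) (trans (*-congˡ (+-assoc s p u)) (distribˡ p s _)) ⟩
    (s * u + s * (d * (s + p))) + (p * s + p * (p + u))
      ≈⟨ +-congʳ (+-comm _ _) ⟩
    (s * (d * (s + p)) + s * u) + (p * s + p * (p + u))
      ≈⟨ +-assoc _ _ _ ⟩
    s * (d * (s + p)) + (s * u + (p * s + p * (p + u)))
      ≈⟨ +-congˡ (sym (+-assoc _ _ _)) ⟩
    s * (d * (s + p)) + ((s * u + p * s) + p * (p + u))
      ≈⟨ +-congˡ (+-congʳ (trans (+-congˡ (*-comm p s)) (trans (+-comm _ _) (sym (distribˡ s p u))))) ⟩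
    s * (d * (s + p)) + (s * (p + u) + p * (p + u))
      ≈⟨ +-cong (solve 3 (λ s d r → s ⊕ (d ⊕ r) ⊜ r ⊕ (d ⊕ s)) ≡.refl (s ∷ d ∷ (s + p) ∷ [])) (sym (distribʳ (p + u) s p)) ⟩
    (s + p) * (d * s) + (s + p) * (p + u)
      ≈⟨ +-comm _ _ ⟩
    (s + p) * (p + u) + (s + p) * (d * s)
      ≈⟨ distribˡ (s + p) _ _ ⟨
    (s + p) * ((p + u) + d * s) ∎

  W-exchange : ∀ k → k < N → ΣP k * W (2 ℕ.+ k) + P (suc k) * W 0 ≈ ΣP (suc k) * W (suc k)
  W-exchange k k<N = begin
    ΣP k * W (2 ℕ.+ k) + P (suc k) * W 0
      ≈⟨ +-cong (*-congˡ (W-head (suc k) e eq₁)) (*-congˡ (W-zero (suc k) e eq₁)) ⟩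
    ΣP k * (rest + D * ΣP (suc k)) + P (suc k) * (ΣP (suc k) + rest)
      ≈⟨ expand (ΣP k) (P (suc k)) rest D ⟩
    ΣP (suc k) * ((P (suc k) + rest) + D * ΣP k)
      ≈⟨ *-congˡ (+-congʳ (tail-peel (suc k) e)) ⟨
    ΣP (suc k) * (sumUpTo (suc e) (λ d → P (suc k ℕ.+ d)) + D * ΣP k)
      ≈⟨ *-congˡ (W-head k (suc e) eq₂) ⟨
    ΣP (suc k) * W (suc k) ∎
    where
    e = N ∸ suc k
    rest = sumUpTo e (λ d → P (2 ℕ.+ k ℕ.+ d))
    eq₁ : suc k ℕ.+ suc e ≡ suc N
    eq₁ = ≡.trans (ℕP.+-suc (suc k) e) (cong suc (ℕP.m+[n∸m]≡n k<N))
    eq₂ : k ℕ.+ suc (suc e) ≡ suc N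
    eq₂ = ≡.trans (ℕP.+-suc k (suc e)) eq₁

  record Row (B : Mat {ℓ} {m} {n}) (k : ℕ) (u : Vtx ℓ m n) (p q : ℕ) : Set where
    field
      k≤p   : k ≤ p
      k≤q   : k ≤ q
      p<n   : p < n
      q<n   : q < n
      entry : ∀ i → k ≤ toℕ i → B u (vc i) ≡ δ p (toℕ i) ℤ.- δ q (toℕ i)

  through-pos : ∀ r → through {ℓ} {m} {n} (+ 1) r ≡ + pos {ℓ} {m} {n} r
  through-pos r = cong +_ (ℕP.+-identityʳ _)

  through-zeroʳ : ∀ r → through {ℓ} {m} {n} r (+ 0) ≡ + 0
  through-zeroʳ r = cong +_ (ℕP.*-zeroʳ (pos {ℓ} {m} {n} r))

  through-minusʳ : ∀ r → through {ℓ} {m} {n} r -[1+ 0 ] ≡ + 0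
  through-minusʳ r = cong +_ (ℕP.*-zeroʳ (pos {ℓ} {m} {n} r))

  -- Preserves the shape of the rows: the arrows added through the mutated vertex are the positive
  -- part of a difference of unit vectors, which is again one unit vector as long as the two are
  -- distinct.
  pos-δ : ∀ {p q} i → p ≢ q → + pos {ℓ} {m} {n} (δ p i ℤ.- δ q i) ≡ δ p i
  pos-δ {p} {q} i p≢q = by (p ℕ.≟ i) (q ℕ.≟ i)
    where
    values : ∀ {r s} → δ p i ≡ + r → δ q i ≡ + s → + pos {ℓ} {m} {n} (+ r ℤ.- + s) ≡ + r →
             + pos {ℓ} {m} {n} (δ p i ℤ.- δ q i) ≡ δ p i
    values ep eq e = ≡.trans (cong₂ (λ a b → + pos {ℓ} {m} {n} (a ℤ.- b)) ep eq) (≡.trans e (≡.sym ep))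
    by : Dec (p ≡ i) → Dec (q ≡ i) → + pos {ℓ} {m} {n} (δ p i ℤ.- δ q i) ≡ δ p i
    by (yes ≡.refl) (yes ≡.refl) = contradiction ≡.refl p≢q
    by (yes ≡.refl) (no q≢i)     = values (δ-same p) (δ-diff q≢i) ≡.refl
    by (no p≢i)     (yes ≡.refl) = values (δ-diff p≢i) (δ-same q) ≡.refl
    by (no p≢i)     (no q≢i)     = values (δ-diff p≢i) (δ-diff q≢i) ≡.refl

  module Step (k : ℕ) (k<N : k < N) (B : Mat {ℓ} {m} {n}) (skew : Skew B)
              (row-k : Row B k (C k) (suc k) (suc N)) where

    K = C k
    B₁ = mutQ K B

    k<n : k < n
    k<n = ℕP.<-trans k<N (ℕP.m<n+m N ℕ.z<s)

    toℕ-k : toℕ (k mod n) ≡ k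
    toℕ-k = toℕ-mod n k<n

    vc≢K : ∀ {i} → k < toℕ i → vc i ≢ K
    vc≢K k<i ≡.refl = ℕP.<-irrefl (≡.sym toℕ-k) k<i

    out : ∀ i → k ≤ toℕ i → B K (vc i) ≡ δ (suc k) (toℕ i) ℤ.- δ (suc N) (toℕ i)
    out = Row.entry row-k

    into : ∀ i → k ≤ toℕ i → B (vc i) K ≡ δ (suc N) (toℕ i) ℤ.- δ (suc k) (toℕ i)
    into i k≤i = ≡.trans (skew (vc i) K) (≡.trans (cong ℤ.-_ (out i k≤i))
      (neg-minus (δ (suc k) (toℕ i)) (δ (suc N) (toℕ i))))

    1+k≢1+N : suc k ≢ suc N
    1+k≢1+N e = ℕP.<-irrefl (ℕP.suc-injective e) k<N

    -- Among the columns still to be mutated, `K` has one arrow out, to `suc k`, and one arrow in,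
    -- from `suc N`. So an arrow from `u` to `K` is prolonged to `suc k` (`entry-plus`), an arrow
    -- from `K` to `u` is extended backwards to `suc N` (`entry-minus`), and without either nothing
    -- happens.
    entry-zero : ∀ {u} i → u ≢ K → k < toℕ i → B u K ≡ + 0 → B₁ u (vc i) ≡ B u (vc i)
    entry-zero {u} i u≢K k<i uK = ≡.trans (mutQ-other K B u≢K (vc≢K k<i))
      (≡.trans (cong₂ (λ r r′ → (B u (vc i) ℤ.+ through {ℓ} {m} {n} r (B K (vc i))) ℤ.- through {ℓ} {m} {n} (B (vc i) K) r′)
                 uK (≡.trans (skew K u) (cong ℤ.-_ uK)))
      (≡.trans (cong (λ x → (B u (vc i) ℤ.+ + 0) ℤ.- x) (through-zeroʳ (B (vc i) K)))
        (plus-zero-minus-zero (B u (vc i)))))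

    entry-plus : ∀ {u} i → u ≢ K → k < toℕ i → B u K ≡ + 1 → B₁ u (vc i) ≡ B u (vc i) ℤ.+ δ (suc k) (toℕ i)
    entry-plus {u} i u≢K k<i uK = ≡.trans (mutQ-other K B u≢K (vc≢K k<i))
      (≡.trans (cong₂ (λ r r′ → (B u (vc i) ℤ.+ through {ℓ} {m} {n} r (B K (vc i))) ℤ.- through {ℓ} {m} {n} (B (vc i) K) r′)
                 uK (≡.trans (skew K u) (cong ℤ.-_ uK)))
      (≡.trans (cong₂ (λ x x′ → (B u (vc i) ℤ.+ x) ℤ.- x′)
                 (≡.trans (through-pos (B K (vc i))) (≡.trans (cong (λ r → + pos {ℓ} {m} {n} r) (out i (ℕP.<⇒≤ k<i))) (pos-δ (toℕ i) 1+k≢1+N)))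
                 (through-minusʳ (B (vc i) K)))
        (ℤP.+-identityʳ _)))

    entry-minus : ∀ {u} i → u ≢ K → k < toℕ i → B u K ≡ -[1+ 0 ] → B₁ u (vc i) ≡ B u (vc i) ℤ.- δ (suc N) (toℕ i)
    entry-minus {u} i u≢K k<i uK = ≡.trans (mutQ-other K B u≢K (vc≢K k<i))
      (≡.trans (cong₂ (λ r r′ → (B u (vc i) ℤ.+ through {ℓ} {m} {n} r (B K (vc i))) ℤ.- through {ℓ} {m} {n} (B (vc i) K) r′)
                 uK (≡.trans (skew K u) (cong ℤ.-_ uK)))
      (cong₂ ℤ._-_ (ℤP.+-identityʳ (B u (vc i)))
        (≡.trans (through-comm {ℓ} {m} {n} (B (vc i) K) (+ 1)) (≡.trans (through-pos (B (vc i) K))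
          (≡.trans (cong (λ r → + pos {ℓ} {m} {n} r) (into i (ℕP.<⇒≤ k<i))) (pos-δ (toℕ i) (1+k≢1+N ∘ ≡.sym)))))))
      where open import Function using (_∘_)

    at-K : ∀ {u p q} → Row B k u p q → B u K ≡ δ p k ℤ.- δ q k
    at-K {p = p} {q} r = ≡.trans (Row.entry r (k mod n) (ℕP.≤-reflexive (≡.sym toℕ-k)))
      (cong (λ i → δ p i ℤ.- δ q i) toℕ-k)

    at-K-skip : ∀ {u p q} → Row B k u p q → k < p → k < q → B u K ≡ + 0
    at-K-skip r k<p k<q = ≡.trans (at-K r) (cong₂ ℤ._-_ (δ-diff (ℕP.>⇒≢ k<p)) (δ-diff (ℕP.>⇒≢ k<q)))

    at-K-plus : ∀ {u q} → Row B k u k q → k < q → B u K ≡ + 1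
    at-K-plus r k<q = ≡.trans (at-K r) (cong₂ ℤ._-_ (δ-same k) (δ-diff (ℕP.>⇒≢ k<q)))

    at-K-minus : ∀ {u p} → Row B k u p k → k < p → B u K ≡ -[1+ 0 ]
    at-K-minus r k<p = ≡.trans (at-K r) (cong₂ ℤ._-_ (δ-diff (ℕP.>⇒≢ k<p)) (δ-same k))

    at-K-zero : ∀ {u} → Row B k u k k → B u K ≡ + 0
    at-K-zero r = ≡.trans (at-K r) (cong₂ ℤ._-_ (δ-same k) (δ-same k))

    1+k<n : suc k < n
    1+k<n = ℕ.s≤s (ℕP.<-trans k<N (ℕP.n<1+n N))

    skip : ∀ {u p q} → u ≢ K → Row B k u p q → k < p → k < q → Row B₁ (suc k) u p q
    skip u≢K r k<p k<q = record
      { k≤p = k<p ; k≤q = k<q ; p<n = Row.p<n r ; q<n = Row.q<n r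
      ; entry = λ i k<i → ≡.trans (entry-zero i u≢K k<i (at-K-skip r k<p k<q)) (Row.entry r i (ℕP.<⇒≤ k<i)) }

    plus : ∀ {u q} → u ≢ K → Row B k u k q → k < q → Row B₁ (suc k) u (suc k) q
    plus {q = q} u≢K r k<q = record
      { k≤p = ℕP.≤-refl ; k≤q = k<q ; p<n = 1+k<n ; q<n = Row.q<n r
      ; entry = λ i k<i → ≡.trans (entry-plus i u≢K k<i (at-K-plus r k<q))
          (≡.trans (cong (ℤ._+ δ (suc k) (toℕ i)) (≡.trans (Row.entry r i (ℕP.<⇒≤ k<i))
                     (cong (ℤ._- δ q (toℕ i)) (δ-diff (ℕP.<⇒≢ k<i)))))
            (zero-minus-plus (δ q (toℕ i)) (δ (suc k) (toℕ i)))) }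

    minus : ∀ {u p} → u ≢ K → Row B k u p k → k < p → Row B₁ (suc k) u p (suc N)
    minus {p = p} u≢K r k<p = record
      { k≤p = k<p ; k≤q = ℕ.s≤s (ℕP.<⇒≤ k<N) ; p<n = Row.p<n r ; q<n = ℕP.≤-refl
      ; entry = λ i k<i → ≡.trans (entry-minus i u≢K k<i (at-K-minus r k<p))
          (cong (ℤ._- δ (suc N) (toℕ i)) (≡.trans (Row.entry r i (ℕP.<⇒≤ k<i))
            (≡.trans (cong (λ x → δ p (toℕ i) ℤ.- x) (δ-diff (ℕP.<⇒≢ k<i))) (ℤP.+-identityʳ (δ p (toℕ i)))))) }

    -- A row that has collapsed to zero; it is written with both positions one higher because
    -- positions must not fall behind the current vertex.
    stay : ∀ {u} → u ≢ K → Row B k u k k → Row B₁ (suc k) u (suc k) (suc k)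
    stay u≢K r = record
      { k≤p = ℕP.≤-refl ; k≤q = ℕP.≤-refl ; p<n = 1+k<n ; q<n = 1+k<n
      ; entry = λ i k<i → ≡.trans (entry-zero i u≢K k<i (at-K-zero r))
          (≡.trans (Row.entry r i (ℕP.<⇒≤ k<i))
            (minus-self (δ k (toℕ i)) (δ (suc k) (toℕ i)))) }

    reverse : Row B₁ (suc k) K (suc N) (suc k)
    reverse = record
      { k≤p = ℕ.s≤s (ℕP.<⇒≤ k<N) ; k≤q = ℕP.≤-refl ; p<n = ℕP.≤-refl ; q<n = 1+k<n
      ; entry = λ i k<i → ≡.trans (mutQ-self-row K B (vc i))
          (≡.trans (cong ℤ.-_ (out i (ℕP.<⇒≤ k<i)))
            (neg-minus (δ (suc k) (toℕ i)) (δ (suc N) (toℕ i)))) }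

    module Values (y : Vtx ℓ m n → Carrier) where
      s = yseed B y
      y₁ = yvar (μ K s)

      value : ∀ {u r} → u ≢ K → B u K ≡ r → y₁ u ≈ exchange r (y u) (y K)
      value {u} u≢K uK = reflexive (≡.trans (μ-other K s u≢K) (cong (λ r → exchange r (y u) (y K)) uK))

      value-zero : ∀ {u} → u ≢ K → B u K ≡ + 0 → y₁ u ≈ y u
      value-zero {u} u≢K uK = trans (value u≢K uK) (exchange-zero (y u) (y K))

      value-plus : ∀ {u} → u ≢ K → B u K ≡ + 1 → y₁ u ≈ y u * (1# + y K)
      value-plus u≢K uK = trans (value u≢K uK) (exchange-one _ _)

      value-minus : ∀ {u} → u ≢ K → B u K ≡ -[1+ 0 ] → y₁ u ≈ y u * (y K / (1# + y K))
      value-minus u≢K uK = trans (value u≢K uK) (exchange-minus-one _ _)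

      value-self : y₁ K ≈ y K ⁻¹
      value-self = reflexive (μ-self K s)

module Run {c₁ ℓ₁ : Level} (S : Semifield c₁ ℓ₁) (N ℓ m : ℕ)
           (c : Fin (2 ℕ.+ N) → Semifield.Carrier S) where
  open Semifield S renaming (_≈_ to infix 4 _≈_; _⁻¹ to infixl 8 _⁻¹)
  open YSeeds S renaming (_/_ to infixl 7 _/_)
  open SemifieldProperties S
  open Seeds S {ℓ} {m} {2 ℕ.+ N}
  open CyclicProducts S (suc N) c
  open Forward S N ℓ m c
  open import Relation.Binary.Reasoning.Setoid setoid

  -- True of all outer and inner faces and of the middle faces already mutated. On these the
  -- quotient of the two runs has the form of the action of T on a face.
  Settled : ℕ → Vtx ℓ m n → Set
  Settled k u = ∀ i → u ≡ vc i → toℕ i < k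

  -- y and y′ are the weights before the mutation at k of the two runs, from the
  -- face weights and from their images under T.  The vertices still to be mutated
  -- carry an additional factor D⁻¹ in y′ / y, hence the separate fields for them.
  record Invariant (k : ℕ) (B : Mat {ℓ} {m} {n}) (y y′ : Vtx ℓ m n → Carrier) : Set (c₁ ⊔ ℓ₁) where
    field
      skew       : Skew B
      row-now    : Row B k (C k) (suc k) (suc N)
      y-now      : y (C k) ≈ P (suc k) / ΣP k
      y′-now     : y′ (C k) ≈ y (C k) * (W 0 / W (2 ℕ.+ k))
      row-later  : ∀ j → k < j → j ≤ N → Row B k (C j) (suc j) (j ∸ 1)
      y-later    : ∀ j → k < j → j ≤ N → y (C j) ≈ c (j mod n)
      y′-later   : ∀ j → k < j → j ≤ N → y′ (C j) ≈ y (C j) * (W j / W (2 ℕ.+ j))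
      row-last   : Row B k (C (suc N)) k N
      y-last     : y (C (suc N)) ≈ c (suc N mod n) * ΣP k
      y′-last    : y′ (C (suc N)) ≈ y (C (suc N)) * (W (suc N) / (W (suc k) * D))
      settled    : ∀ u → Settled k u → ∃₂ λ p q → Row B k u p q × (y u ⟶ y′ u by p , q)

  C-index : ∀ {j} → j < n → toℕ (j mod n) ≡ j
  C-index = toℕ-mod n

  C-injective : ∀ {j k} → j < n → k < n → C j ≡ C k → j ≡ k
  C-injective j<n k<n e = ≡.trans (≡.sym (C-index j<n)) (≡.trans (cong toℕ (vc-injective e)) (C-index k<n))
    where
    vc-injective : ∀ {i j : Fin n} → vc {ℓ} {m} i ≡ vc j → i ≡ j
    vc-injective ≡.refl = ≡.refl

  P-suc : ∀ k → P (suc k) ≈ P k * c (k mod n)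
  P-suc = prodR-suc (λ s → c (s mod n))

  W-n : W n ≈ D * W 0
  W-n = trans (reflexive (cong W (≡.sym (ℕP.+-identityʳ n)))) (W-periodic 0)

  step : ∀ k → k < N → ∀ B y y′ → Invariant k B y y′ →
         Invariant (suc k) (mutQ (C k) B) (yvar (μ (C k) (yseed B y))) (yvar (μ (C k) (yseed B y′)))
  step k k<N B y y′ inv = record
    { skew      = mutQ-skew K B I.skew
    -- The row of `C (suc k)` is still the initial e_(k+2) - e_k. Mutation at `k` moves its negative
    -- position to `suc N`, which is the shape required of the next vertex to be mutated.
    ; row-now   = minus ≢K₁ row₁ k<2+k
    ; y-now     = begin
        y₁ (C (suc k))                           ≈⟨ F.value-minus ≢K₁ (at-K-minus row₁ k<2+k) ⟩
        y (C (suc k)) * (Y / (1# + Y))           ≈⟨ *-cong (I.y-later (suc k) ℕP.≤-refl k<N) down ⟩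
        c₁₊ₖ * (P (suc k) / ΣP (suc k))           ≈⟨ solve 3 (λ c p s → c ⊕ (p ⊖ s) ⊜ (p ⊕ c) ⊖ s) ≡.refl (c₁₊ₖ ∷ P (suc k) ∷ ΣP (suc k) ∷ []) ⟩
        P (suc k) * c₁₊ₖ / ΣP (suc k)             ≈⟨ *-congʳ (P-suc (suc k)) ⟨
        P (2 ℕ.+ k) / ΣP (suc k)                 ∎
    ; y′-now    = begin
        y₁′ (C (suc k))
          ≈⟨ F′.value-minus ≢K₁ (at-K-minus row₁ k<2+k) ⟩
        y′ (C (suc k)) * (Y′ / (1# + Y′))
          ≈⟨ *-cong (I.y′-later (suc k) ℕP.≤-refl k<N) down′ ⟩
        (y (C (suc k)) * (W (suc k) / W (3 ℕ.+ k))) * ((Y / (1# + Y)) * (W 0 / W (suc k)))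
          ≈⟨ solve 5 (λ y f w₁ w₃ w₀ → (y ⊕ (w₁ ⊖ w₃)) ⊕ (f ⊕ (w₀ ⊖ w₁)) ⊜ (y ⊕ f) ⊕ (w₀ ⊖ w₃)) ≡.refl
               (y (C (suc k)) ∷ Y / (1# + Y) ∷ W (suc k) ∷ W (3 ℕ.+ k) ∷ W 0 ∷ []) ⟩
        (y (C (suc k)) * (Y / (1# + Y))) * (W 0 / W (3 ℕ.+ k))
          ≈⟨ *-congʳ (F.value-minus ≢K₁ (at-K-minus row₁ k<2+k)) ⟨
        y₁ (C (suc k)) * (W 0 / W (3 ℕ.+ k)) ∎
    ; row-later = λ j k+1<j j≤N → skip (later≢K k+1<j j≤N) (row-of k+1<j j≤N) (k<1+j k+1<j) (k<j-1 k+1<j)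
    ; y-later   = λ j k+1<j j≤N → trans (unchanged k+1<j j≤N) (I.y-later j (ℕP.<⇒≤ k+1<j) j≤N)
    ; y′-later  = λ j k+1<j j≤N → trans (unchanged′ k+1<j j≤N) (trans (I.y′-later j (ℕP.<⇒≤ k+1<j) j≤N)
                    (*-congʳ (sym (unchanged k+1<j j≤N))))
    -- The last middle vertex has an arrow to each `C k` when its turn comes, so its weight collects
    -- the telescoping product of the factors `1# + Y`.
    ; row-last  = plus last≢K I.row-last k<N
    ; y-last    = begin
        y₁ L                             ≈⟨ F.value-plus last≢K (at-K-plus I.row-last k<N) ⟩
        y L * (1# + Y)                   ≈⟨ *-cong I.y-last 1+Y ⟩
        (cₙ * ΣP k) * (ΣP (suc k) / ΣP k) ≈⟨ solve 3 (λ c s s₁ → (c ⊕ s) ⊕ (s₁ ⊖ s) ⊜ c ⊕ s₁) ≡.refl (cₙ ∷ ΣP k ∷ ΣP (suc k) ∷ []) ⟩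
        cₙ * ΣP (suc k)                  ∎
    ; y′-last   = begin
        y₁′ L
          ≈⟨ F′.value-plus last≢K (at-K-plus I.row-last k<N) ⟩
        y′ L * (1# + Y′)
          ≈⟨ *-cong I.y′-last 1+Y′ ⟩
        (y L * (W (suc N) / (W (suc k) * D))) * ((1# + Y) * (W (suc k) / W (2 ℕ.+ k)))
          ≈⟨ solve 6 (λ y f wn w₁ d w₂ → (y ⊕ (wn ⊖ (w₁ ⊕ d))) ⊕ (f ⊕ (w₁ ⊖ w₂)) ⊜ (y ⊕ f) ⊕ (wn ⊖ (w₂ ⊕ d))) ≡.refl
               (y L ∷ (1# + Y) ∷ W (suc N) ∷ W (suc k) ∷ D ∷ W (2 ℕ.+ k) ∷ []) ⟩
        (y L * (1# + Y)) * (W (suc N) / (W (2 ℕ.+ k) * D))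
          ≈⟨ *-congʳ (F.value-plus last≢K (at-K-plus I.row-last k<N)) ⟨
        y₁ L * (W (suc N) / (W (2 ℕ.+ k) * D)) ∎
    ; settled   = λ u set → settled₁ u set (u ≟V K)
    }
    where
    module I = Invariant inv
    open Step k k<N B I.skew I.row-now
    module F  = Values y
    module F′ = Values y′
    open F using (y₁)
    open F′ renaming (y₁ to y₁′) using ()
    L    = C (suc N)
    Y    = y K
    Y′   = y′ K
    c₁₊ₖ = c (suc k mod n)
    cₙ   = c (suc N mod n)

    1+Y : 1# + Y ≈ ΣP (suc k) / ΣP k
    1+Y = trans (+-congˡ I.y-now) (1+fraction (P (suc k)) (ΣP k))

    -- This ratio of the two runs replaces `W (suc k)` by `W (2 + k)` in a denominator, just as the
    -- row moves its positive position from `k` to `suc k`. It is the only place where the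
    -- three-term identity enters; `down′` follows from it.
    1+Y′ : 1# + Y′ ≈ (1# + Y) * (W (suc k) / W (2 ℕ.+ k))
    1+Y′ = begin
      1# + Y′
        ≈⟨ +-congˡ (trans I.y′-now (*-congʳ I.y-now)) ⟩
      1# + (P (suc k) / ΣP k) * (W 0 / W (2 ℕ.+ k))
        ≈⟨ +-congˡ (solve 4 (λ p s w₀ w₂ → (p ⊖ s) ⊕ (w₀ ⊖ w₂) ⊜ (p ⊕ w₀) ⊖ (s ⊕ w₂)) ≡.refl
             (P (suc k) ∷ ΣP k ∷ W 0 ∷ W (2 ℕ.+ k) ∷ [])) ⟩
      1# + (P (suc k) * W 0) / (ΣP k * W (2 ℕ.+ k))
        ≈⟨ 1+fraction _ _ ⟩
      (ΣP k * W (2 ℕ.+ k) + P (suc k) * W 0) / (ΣP k * W (2 ℕ.+ k))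
        ≈⟨ *-congʳ (W-exchange k k<N) ⟩
      (ΣP (suc k) * W (suc k)) / (ΣP k * W (2 ℕ.+ k))
        ≈⟨ solve 4 (λ s₁ w₁ s w₂ → (s₁ ⊕ w₁) ⊖ (s ⊕ w₂) ⊜ (s₁ ⊖ s) ⊕ (w₁ ⊖ w₂)) ≡.refl
             (ΣP (suc k) ∷ W (suc k) ∷ ΣP k ∷ W (2 ℕ.+ k) ∷ []) ⟩
      (ΣP (suc k) / ΣP k) * (W (suc k) / W (2 ℕ.+ k))
        ≈⟨ *-congʳ 1+Y ⟨
      (1# + Y) * (W (suc k) / W (2 ℕ.+ k)) ∎

    down : Y / (1# + Y) ≈ P (suc k) / ΣP (suc k)
    down = trans (*-cong I.y-now (⁻¹-cong 1+Y))
      (solve 3 (λ p s s₁ → (p ⊖ s) ⊖ (s₁ ⊖ s) ⊜ p ⊖ s₁) ≡.refl (P (suc k) ∷ ΣP k ∷ ΣP (suc k) ∷ []))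

    down′ : Y′ / (1# + Y′) ≈ (Y / (1# + Y)) * (W 0 / W (suc k))
    down′ = trans (*-cong I.y′-now (⁻¹-cong 1+Y′))
      (solve 5 (λ y w₀ w₂ f w₁ → (y ⊕ (w₀ ⊖ w₂)) ⊖ (f ⊕ (w₁ ⊖ w₂)) ⊜ (y ⊖ f) ⊕ (w₀ ⊖ w₁)) ≡.refl
        (Y ∷ W 0 ∷ W (2 ℕ.+ k) ∷ (1# + Y) ∷ W (suc k) ∷ []))

    ≢K : ∀ {j} → k < j → j < n → C j ≢ K
    ≢K k<j j<n e = ℕP.<⇒≢ k<j (≡.sym (C-injective j<n k<n e))

    k<2+k : k < 2 ℕ.+ k
    k<2+k = ℕP.m<n+m k ℕ.z<s

    ≢K₁ : C (suc k) ≢ K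
    ≢K₁ = ≢K ℕP.≤-refl 1+k<n

    last≢K : L ≢ K
    last≢K = ≢K (ℕP.<-trans k<N (ℕP.n<1+n N)) ℕP.≤-refl

    row₁ : Row B k (C (suc k)) (2 ℕ.+ k) k
    row₁ = I.row-later (suc k) ℕP.≤-refl k<N

    later≢K : ∀ {j} → suc k < j → j ≤ N → C j ≢ K
    later≢K k+1<j j≤N = ≢K (ℕP.<⇒≤ k+1<j) (ℕ.s≤s (ℕP.≤-trans j≤N (ℕP.n≤1+n N)))

    row-of : ∀ {j} → suc k < j → j ≤ N → Row B k (C j) (suc j) (j ∸ 1)
    row-of k+1<j j≤N = I.row-later _ (ℕP.<⇒≤ k+1<j) j≤N

    k<1+j : ∀ {j} → suc k < j → k < suc j
    k<1+j k+1<j = ℕ.s≤s (ℕP.<⇒≤ (ℕP.<⇒≤ k+1<j))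

    k<j-1 : ∀ {j} → suc k < j → k < j ∸ 1
    k<j-1 k+1<j = ℕP.∸-monoˡ-≤ 1 k+1<j

    unchanged : ∀ {j} → suc k < j → j ≤ N → y₁ (C j) ≈ y (C j)
    unchanged k+1<j j≤N = F.value-zero (later≢K k+1<j j≤N) (at-K-skip (row-of k+1<j j≤N) (k<1+j k+1<j) (k<j-1 k+1<j))

    unchanged′ : ∀ {j} → suc k < j → j ≤ N → y₁′ (C j) ≈ y′ (C j)
    unchanged′ k+1<j j≤N = F′.value-zero (later≢K k+1<j j≤N) (at-K-skip (row-of k+1<j j≤N) (k<1+j k+1<j) (k<j-1 k+1<j))

    Goal : Vtx ℓ m n → Set ℓ₁
    Goal u = ∃₂ λ p q → Row B₁ (suc k) u p q × (y₁ u ⟶ y₁′ u by p , q)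

    transfer : ∀ u → u ≢ K → ∀ p q → Row B k u p q → y u ⟶ y′ u by p , q → Goal u
    transfer u u≢K p q r (up p≤q e) with ℕP.m≤n⇒m<n∨m≡n (Row.k≤p r)
    ... | inj₁ k<p = p , q , skip u≢K r k<p k<q , up p≤q (begin
        y₁′ u                              ≈⟨ F′.value-zero u≢K (at-K-skip r k<p k<q) ⟩
        y′ u                               ≈⟨ e ⟩
        y u * (W (suc q) / W (suc p))      ≈⟨ *-congʳ (F.value-zero u≢K (at-K-skip r k<p k<q)) ⟨
        y₁ u * (W (suc q) / W (suc p))     ∎)
      where
      k<q : k < q
      k<q = ℕP.<-≤-trans k<p p≤q
    ... | inj₂ ≡.refl with ℕP.m≤n⇒m<n∨m≡n p≤q
    ...   | inj₁ k<q = suc k , q , plus u≢K r k<q , up k<q (begin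
        y₁′ u
          ≈⟨ F′.value-plus u≢K (at-K-plus r k<q) ⟩
        y′ u * (1# + Y′)
          ≈⟨ *-cong e 1+Y′ ⟩
        (y u * (W (suc q) / W (suc k))) * ((1# + Y) * (W (suc k) / W (2 ℕ.+ k)))
          ≈⟨ solve 5 (λ y f wq w₁ w₂ → (y ⊕ (wq ⊖ w₁)) ⊕ (f ⊕ (w₁ ⊖ w₂)) ⊜ (y ⊕ f) ⊕ (wq ⊖ w₂)) ≡.refl
               (y u ∷ (1# + Y) ∷ W (suc q) ∷ W (suc k) ∷ W (2 ℕ.+ k) ∷ []) ⟩
        (y u * (1# + Y)) * (W (suc q) / W (2 ℕ.+ k))
          ≈⟨ *-congʳ (F.value-plus u≢K (at-K-plus r k<q)) ⟨
        y₁ u * (W (suc q) / W (2 ℕ.+ k)) ∎)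
    ...   | inj₂ ≡.refl = suc k , suc k , stay u≢K r , up ℕP.≤-refl (begin
        y₁′ u                                ≈⟨ F′.value-zero u≢K (at-K-zero r) ⟩
        y′ u                                 ≈⟨ e ⟩
        y u * (W (suc k) / W (suc k))        ≈⟨ *-cong (sym (F.value-zero u≢K (at-K-zero r))) (trans (inverseʳ _) (sym (inverseʳ _))) ⟩
        y₁ u * (W (2 ℕ.+ k) / W (2 ℕ.+ k))   ∎)
    transfer u u≢K p q r (wrap q<p e) with ℕP.m≤n⇒m<n∨m≡n (Row.k≤q r)
    ... | inj₁ k<q = p , q , skip u≢K r k<p k<q , wrap q<p (begin
        y₁′ u                                ≈⟨ F′.value-zero u≢K (at-K-skip r k<p k<q) ⟩
        y′ u                                 ≈⟨ e ⟩
        y u * (D * (W (suc q) / W (suc p)))  ≈⟨ *-congʳ (F.value-zero u≢K (at-K-skip r k<p k<q)) ⟨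
        y₁ u * (D * (W (suc q) / W (suc p))) ∎)
      where
      k<p : k < p
      k<p = ℕP.<-trans k<q q<p
    -- Moving the negative position from `k` to `suc N` unwraps the row; correspondingly the
    -- explicit `D` is absorbed, as `D * W 0` is `W n`.
    ... | inj₂ ≡.refl = p , suc N , minus u≢K r q<p , up (ℕP.<⇒≤pred (Row.p<n r)) (begin
        y₁′ u
          ≈⟨ F′.value-minus u≢K (at-K-minus r q<p) ⟩
        y′ u * (Y′ / (1# + Y′))
          ≈⟨ *-cong e down′ ⟩
        (y u * (D * (W (suc k) / W (suc p)))) * ((Y / (1# + Y)) * (W 0 / W (suc k)))
          ≈⟨ solve 6 (λ y f d w₁ wp w₀ → (y ⊕ (d ⊕ (w₁ ⊖ wp))) ⊕ (f ⊕ (w₀ ⊖ w₁)) ⊜ (y ⊕ f) ⊕ ((d ⊕ w₀) ⊖ wp)) ≡.refl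
               (y u ∷ Y / (1# + Y) ∷ D ∷ W (suc k) ∷ W (suc p) ∷ W 0 ∷ []) ⟩
        (y u * (Y / (1# + Y))) * ((D * W 0) / W (suc p))
          ≈⟨ *-cong (sym (F.value-minus u≢K (at-K-minus r q<p))) (*-congʳ (sym W-n)) ⟩
        y₁ u * (W n / W (suc p)) ∎)

    settled₁ : ∀ u → Settled (suc k) u → Dec (u ≡ K) → Goal u
    -- Mutation inverts the weight at `K` and exchanges its two positions, which also exchanges `up`
    -- with `wrap`. The inverse of the factor with the additional `D ⁻¹` is exactly the `wrap`
    -- factor of the reversed row, so `K` becomes settled without a correction.
    settled₁ u set (yes ≡.refl) = suc N , suc k , reverse , wrap (ℕ.s≤s k<N) (begin
        y₁′ K
          ≈⟨ F′.value-self ⟩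
        Y′ ⁻¹
          ≈⟨ ⁻¹-cong I.y′-now ⟩
        (Y * (W 0 / W (2 ℕ.+ k))) ⁻¹
          ≈⟨ solve 4 (λ y w₀ w₂ d → neg (y ⊕ (w₀ ⊖ w₂)) ⊜ neg y ⊕ (d ⊕ (w₂ ⊖ (d ⊕ w₀)))) ≡.refl
               (Y ∷ W 0 ∷ W (2 ℕ.+ k) ∷ D ∷ []) ⟩
        Y ⁻¹ * (D * (W (2 ℕ.+ k) / (D * W 0)))
          ≈⟨ *-cong (sym F.value-self) (*-congˡ (*-congˡ (⁻¹-cong (sym W-n)))) ⟩
        y₁ K * (D * (W (2 ℕ.+ k) / W n)) ∎)
    settled₁ u set (no u≢K) with I.settled u (λ i u≡i → ℕP.≤∧≢⇒< (ℕ.s≤s⁻¹ (set i u≡i))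
        (λ i≡k → u≢K (≡.trans u≡i (cong vc (toℕ-injective (≡.trans i≡k (≡.sym toℕ-k)))))))
    ... | p , q , r , e = transfer u u≢K p q r e

-- The mutations at the last two vertices

module Middle {c₁ ℓ₁ : Level} (S : Semifield c₁ ℓ₁) (N ℓ m : ℕ)
              (c : Fin (2 ℕ.+ N) → Semifield.Carrier S) where
  open Semifield S renaming (_≈_ to infix 4 _≈_; _⁻¹ to infixl 8 _⁻¹)
  open YSeeds S renaming (_/_ to infixl 7 _/_)
  open SemifieldProperties S
  open Seeds S {ℓ} {m} {2 ℕ.+ N}
  open CyclicProducts S (suc N) c
  open Forward S N ℓ m c
  open Run S N ℓ m c
  open import Relation.Binary.Reasoning.Setoid setoid

  module _ (B : Mat {ℓ} {m} {n}) (y y′ : Vtx ℓ m n → Carrier) (inv : Invariant N B y y′) where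
    private
      module I = Invariant inv
      K = C N
      L = C (suc N)
      B₁ = mutQ K B
      B₂ = mutQ L B₁
      s  = yseed B y
      s₁ = μ K s
      s₂ = μ L s₁
      th = through {ℓ} {m} {n}

    N<n : N < n
    N<n = ℕP.m<n+m N ℕ.z<s

    K≢L : K ≢ L
    K≢L e = ℕP.<⇒≢ (ℕP.n<1+n N) (C-injective N<n ℕP.≤-refl e)

    data Position : Vtx ℓ m n → Set where
      isK   : Position K
      isL   : Position L
      other : ∀ {u} → u ≢ K → u ≢ L → Position u

    position : ∀ u → Position u
    position u with u ≟V K | u ≟V L
    ... | yes ≡.refl | _          = isK
    ... | no _       | yes ≡.refl = isL
    ... | no u≢K     | no u≢L     = other u≢K u≢L

    other-settled : ∀ {u} → u ≢ K → u ≢ L → Settled N u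
    other-settled u≢K u≢L i ≡.refl = ℕP.≤∧≢⇒< (ℕP.≤-pred i<1+N) (at u≢K N<n)
      where
      at : ∀ {j} → vc i ≢ C j → j < n → toℕ i ≢ j
      at i≢j j<n e = i≢j (cong vc (toℕ-injective (≡.trans e (≡.sym (C-index j<n)))))
      i<1+N : toℕ i < suc N
      i<1+N = ℕP.≤∧≢⇒< (ℕ.s≤s⁻¹ (toℕ<n i)) (at u≢L ℕP.≤-refl)

    some-row : ∀ u → ∃₂ λ p q → Row B N u p q
    some-row u with position u
    ... | isK = _ , _ , I.row-now
    ... | isL = _ , _ , I.row-last
    ... | other u≢K u≢L with I.settled u (other-settled u≢K u≢L)
    ...   | p , q , r , _ = p , q , r

    data End : ℕ → Set where
      atN   : End N
      at1+N : End (suc N)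

    end : ∀ {p} → N ≤ p → p < n → End p
    end N≤p p<n with ℕP.m≤n⇒m<n∨m≡n N≤p
    ... | inj₂ ≡.refl = atN
    ... | inj₁ N<p with ℕP.≤-antisym N<p (ℕ.s≤s⁻¹ p<n)
    ...   | ≡.refl = at1+N

    at : ∀ {u p q} → Row B N u p q → ∀ j → N ≤ j → j < n → B u (C j) ≡ δ p j ℤ.- δ q j
    at {p = p} {q} r j N≤j j<n = ≡.trans (Row.entry r (j mod n) (≡.subst (N ≤_) (≡.sym (C-index j<n)) N≤j))
      (cong (λ i → δ p i ℤ.- δ q i) (C-index j<n))

    atK : ∀ {u p q} → Row B N u p q → B u K ≡ δ p N ℤ.- δ q N
    atK r = at r N ℕP.≤-refl N<n

    atL : ∀ {u p q} → Row B N u p q → B u L ≡ δ p (suc N) ℤ.- δ q (suc N)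
    atL r = at r (suc N) (ℕP.n≤1+n N) ℕP.≤-refl

    N≢1+N : N ≢ suc N
    N≢1+N = ℕP.<⇒≢ (ℕP.n<1+n N)

    δNN  = δ-same N
    δLL  = δ-same (suc N)
    δNL  = δ-diff N≢1+N
    δLN  = δ-diff (N≢1+N ∘ ≡.sym)

    -- Both positions now lie in the two remaining columns, and the coordinates of a difference of
    -- unit vectors add up to 0.
    opposite : ∀ u → B u L ≡ ℤ.- B u K
    opposite u with some-row u
    ... | p , q , r = ≡.trans (atL r) (≡.trans (by (end (Row.k≤p r) (Row.p<n r)) (end (Row.k≤q r) (Row.q<n r)))
                        (≡.sym (cong ℤ.-_ (atK r))))
      where
      values : ∀ p q {a b a′ b′} → δ p (suc N) ≡ a → δ q (suc N) ≡ b → δ p N ≡ a′ → δ q N ≡ b′ →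
               a ℤ.- b ≡ ℤ.- (a′ ℤ.- b′) → δ p (suc N) ℤ.- δ q (suc N) ≡ ℤ.- (δ p N ℤ.- δ q N)
      values _ _ e₁ e₂ e₃ e₄ e = ≡.trans (cong₂ ℤ._-_ e₁ e₂) (≡.trans e (≡.sym (cong ℤ.-_ (cong₂ ℤ._-_ e₃ e₄))))
      by : End p → End q → δ p (suc N) ℤ.- δ q (suc N) ≡ ℤ.- (δ p N ℤ.- δ q N)
      by atN   atN   = values N N δNL δNL δNN δNN ≡.refl
      by atN   at1+N = values N (suc N) δNL δLL δNN δLN ≡.refl
      by at1+N atN   = values (suc N) N δLL δNL δLN δNN ≡.refl
      by at1+N at1+N = values (suc N) (suc N) δLL δLL δLN δLN ≡.refl

    opposite′ : ∀ u → B u K ≡ ℤ.- B u L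
    opposite′ u = ≡.trans (≡.sym (ℤP.neg-involutive _)) (cong ℤ.-_ (≡.sym (opposite u)))

    BKK : B K K ≡ + 0
    BKK = ≡.trans (atK I.row-now) (ℤP.+-inverseʳ (δ (suc N) N))

    BLK : B L K ≡ + 0
    BLK = ≡.trans (atK I.row-last) (ℤP.+-inverseʳ (δ N N))

    BKL : B K L ≡ + 0
    BKL = ≡.trans (opposite K) (cong ℤ.-_ BKK)

    BLL : B L L ≡ + 0
    BLL = ≡.trans (opposite L) (cong ℤ.-_ BLK)

    B₁-skew : Skew B₁
    B₁-skew = mutQ-skew K B I.skew

    B₂-skew : Skew B₂
    B₂-skew = mutQ-skew L B₁ B₁-skew

    B₁-KL : B₁ K L ≡ + 0
    B₁-KL = ≡.trans (mutQ-self-row K B L) (cong ℤ.-_ BKL)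

    B₁-LK : B₁ L K ≡ + 0
    B₁-LK = ≡.trans (mutQ-self-col K B L) (cong ℤ.-_ BLK)

    B₁-colL : ∀ {u} → u ≢ K → B₁ u L ≡ B u L
    B₁-colL {u} u≢K = ≡.trans (mutQ-other K B u≢K (K≢L ∘ ≡.sym))
      (≡.trans (cong₂ (λ r r′ → (B u L ℤ.+ th (B u K) r) ℤ.- th r′ (B K u)) BKL BLK)
      (≡.trans (cong (λ x → (B u L ℤ.+ x) ℤ.- + 0) (through-zeroʳ (B u K))) (plus-zero-minus-zero (B u L))))

    B₁-rowL : ∀ {u} → u ≢ K → B₁ L u ≡ B L u
    B₁-rowL {u} u≢K = ≡.trans (B₁-skew L u) (≡.trans (cong ℤ.-_ (B₁-colL u≢K)) (≡.sym (I.skew L u)))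

    B₂-colL : ∀ {u} → u ≢ K → B₂ u L ≡ B u K
    B₂-colL {u} u≢K = ≡.trans (mutQ-self-col L B₁ u)
      (≡.trans (cong ℤ.-_ (B₁-colL u≢K)) (≡.sym (opposite′ u)))

    B₂-colK : ∀ {u} → u ≢ L → B₂ u K ≡ B u L
    B₂-colK {u} u≢L = ≡.trans (mutQ-other L B₁ u≢L K≢L)
      (≡.trans (cong₂ (λ r r′ → (B₁ u K ℤ.+ th (B₁ u L) r) ℤ.- th r′ (B₁ L u)) B₁-LK B₁-KL)
      (≡.trans (cong (λ x → (B₁ u K ℤ.+ x) ℤ.- + 0) (through-zeroʳ (B₁ u L)))
      (≡.trans (plus-zero-minus-zero (B₁ u K)) (≡.trans (mutQ-self-col K B u) (≡.sym (opposite u))))))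

    B₂-LK : B₂ L K ≡ + 0
    B₂-LK = ≡.trans (mutQ-self-row L B₁ K) (cong ℤ.-_ B₁-LK)

    B₂-KL : B₂ K L ≡ + 0
    B₂-KL = ≡.trans (mutQ-self-col L B₁ K) (cong ℤ.-_ B₁-KL)

    B₂-LL : B₂ L L ≡ + 0
    B₂-LL = ≡.trans (B₂-colL (K≢L ∘ ≡.sym)) BLK

    -- Every vertex has opposite entries at K and L, so the paths created by
    -- the mutation at L cancel those created by the mutation at K.
    B₂-other : ∀ {u v} → u ≢ K → u ≢ L → v ≢ K → v ≢ L → B₂ u v ≡ B u v
    B₂-other {u} {v} u≢K u≢L v≢K v≢L = ≡.trans (mutQ-other L B₁ u≢L v≢L)
      (≡.trans (cong₂ ℤ._-_ (cong₂ ℤ._+_ (mutQ-other K B u≢K v≢K) (cong₂ th (toL u≢K) (fromL v≢K)))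
                            (cong₂ th (toL v≢K) (fromL u≢K)))
        (paths-cancel {ℓ} {m} {n} (B u v) (through-comm {ℓ} {m} {n} (B K v) (B u K)) (through-comm {ℓ} {m} {n} (B K u) (B v K))))
      where
      fromL : ∀ {v} → v ≢ K → B₁ L v ≡ B v K
      fromL {v} v≢K = ≡.trans (B₁-rowL v≢K) (≡.trans (I.skew L v) (≡.sym (opposite′ v)))
      toL : ∀ {v} → v ≢ K → B₁ v L ≡ B K v
      toL {v} v≢K = ≡.trans (B₁-colL v≢K) (≡.trans (opposite v) (≡.sym (I.skew K v)))

    sw : Vtx ℓ m n → Vtx ℓ m n
    sw = swapV K L

    sw-K : sw K ≡ L
    sw-K with K ≟V K
    ... | yes _  = ≡.refl
    ... | no K≢K = contradiction ≡.refl K≢K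

    sw-L : sw L ≡ K
    sw-L with L ≟V K | L ≟V L
    ... | yes e | _      = contradiction (≡.sym e) K≢L
    ... | no _  | yes _  = ≡.refl
    ... | no _  | no L≢L = contradiction ≡.refl L≢L

    sw-other : ∀ {u} → u ≢ K → u ≢ L → sw u ≡ u
    sw-other {u} u≢K u≢L with u ≟V K | u ≟V L
    ... | yes e | _     = contradiction e u≢K
    ... | no _  | yes e = contradiction e u≢L
    ... | no _  | no _  = ≡.refl

    -- Needed for the descent: it can undo the second run only if it starts from the quiver at which
    -- that run ended. The two mutations negate the columns of `K` and `L`, the swap exchanges them,
    -- and opposite entries make these effects cancel.
    quiver-fixed : ∀ u v → B₂ (sw u) (sw v) ≡ B u v
    quiver-fixed u v = by (position u) (position v)
      where
      by : ∀ {u v} → Position u → Position v → B₂ (sw u) (sw v) ≡ B u v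
      by isK isK = ≡.trans (cong₂ B₂ sw-K sw-K) (≡.trans B₂-LL (≡.sym BKK))
      by isK isL = ≡.trans (cong₂ B₂ sw-K sw-L) (≡.trans B₂-LK (≡.sym BKL))
      by isL isK = ≡.trans (cong₂ B₂ sw-L sw-K) (≡.trans B₂-KL (≡.sym BLK))
      by isL isL = ≡.trans (cong₂ B₂ sw-L sw-L) (≡.trans (B₂-colK K≢L) (≡.trans BKL (≡.sym BLL)))
      by (other a b) isK = ≡.trans (cong₂ B₂ (sw-other a b) sw-K) (B₂-colL a)
      by (other a b) isL = ≡.trans (cong₂ B₂ (sw-other a b) sw-L) (B₂-colK b)
      by {v = v} isK (other a b) = ≡.trans (cong₂ B₂ sw-K (sw-other a b))
        (≡.trans (B₂-skew L v) (≡.trans (cong ℤ.-_ (B₂-colL a)) (≡.sym (I.skew K v))))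
      by {v = v} isL (other a b) = ≡.trans (cong₂ B₂ sw-L (sw-other a b))
        (≡.trans (B₂-skew K v) (≡.trans (cong ℤ.-_ (B₂-colK b)) (≡.sym (I.skew L v))))
      by (other a b) (other a′ b′) = ≡.trans (cong₂ B₂ (sw-other a b) (sw-other a′ b′)) (B₂-other a b a′ b′)

    y₁ y₂ : Vtx ℓ m n → Carrier
    y₁ = yvar s₁
    y₂ = yvar s₂

    y₁-K : y₁ K ≈ y K ⁻¹
    y₁-K = reflexive (μ-self K s)

    y₁-other : ∀ {u} r → u ≢ K → B u K ≡ r → y₁ u ≈ exchange r (y u) (y K)
    y₁-other {u} r u≢K e = reflexive (≡.trans (μ-other K s u≢K) (cong (λ r → exchange r (y u) (y K)) e))

    y₁-L : y₁ L ≈ y L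
    y₁-L = trans (y₁-other (+ 0) (K≢L ∘ ≡.sym) BLK) (exchange-zero (y L) (y K))

    y₂-L : y₂ L ≈ y L ⁻¹
    y₂-L = trans (reflexive (μ-self L s₁)) (⁻¹-cong y₁-L)

    y₂-K : y₂ K ≈ y K ⁻¹
    y₂-K = trans (reflexive (≡.trans (μ-other L s₁ K≢L) (cong (λ r → exchange r (y₁ K) (y₁ L)) B₁-KL)))
      (trans (exchange-zero (y₁ K) (y₁ L)) y₁-K)

    y₂-other : ∀ {u} r → u ≢ K → u ≢ L → B u K ≡ r → y₂ u ≈ exchange (ℤ.- r) (exchange r (y u) (y K)) (y L)
    y₂-other {u} r u≢K u≢L e = trans
      (reflexive (≡.trans (μ-other L s₁ u≢L) (cong (λ r → exchange r (y₁ u) (y₁ L))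
        (≡.trans (B₁-colL u≢K) (≡.trans (opposite u) (cong ℤ.-_ e))))))
      (exchange-cong (ℤ.- r) (y₁-other r u≢K e) y₁-L)

    cₙ = c (suc N mod n)

    D≈ : D ≈ P (suc N) * cₙ
    D≈ = P-suc (suc N)

    end-sum : N ℕ.+ 1 ≡ suc N
    end-sum = ℕP.+-comm N 1

    W-1+N : W (suc N) ≈ P (suc N) + D * ΣP N
    W-1+N = trans (W-head N 0 end-sum) (+-congʳ (reflexive (cong P (ℕP.+-identityʳ (suc N)))))

    1+yK : 1# + y K ≈ W 0 / ΣP N
    1+yK = trans (+-congˡ I.y-now) (1+fraction (P (suc N)) (ΣP N))

    -- Numerator and denominator are the parts of `W (suc N)` after and before the cut, so that
    -- adding `1#` produces `W (suc N)`.
    yL≈ : y L ≈ (D * ΣP N) / P (suc N)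
    yL≈ = begin
      y L                                   ≈⟨ I.y-last ⟩
      cₙ * ΣP N                             ≈⟨ solve 3 (λ c s p → c ⊕ s ⊜ (p ⊕ c ⊕ s) ⊖ p) ≡.refl (cₙ ∷ ΣP N ∷ P (suc N) ∷ []) ⟩
      (P (suc N) * cₙ * ΣP N) / P (suc N)   ≈⟨ *-congʳ (*-congʳ D≈) ⟨
      (D * ΣP N) / P (suc N)                ∎

    1+yL : 1# + y L ≈ W (suc N) / P (suc N)
    1+yL = trans (+-congˡ yL≈) (trans (1+fraction (D * ΣP N) (P (suc N))) (*-congʳ (sym W-1+N)))

    -- The weights at `K` and `L` have product `D`. Inverting and exchanging them therefore divides
    -- each by `D`, which is what the quotients `y′-now` and `y′-last` amount to at `N`.
    value-K : y₂ L ≈ y′ K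
    value-K = begin
      y₂ L
        ≈⟨ trans y₂-L (⁻¹-cong yL≈) ⟩
      ((D * ΣP N) / P (suc N)) ⁻¹
        ≈⟨ solve 4 (λ d s p w → neg ((d ⊕ s) ⊖ p) ⊜ (p ⊖ s) ⊕ (w ⊖ (d ⊕ w))) ≡.refl (D ∷ ΣP N ∷ P (suc N) ∷ W 0 ∷ []) ⟩
      (P (suc N) / ΣP N) * (W 0 / (D * W 0))
        ≈⟨ *-cong I.y-now (*-congˡ (⁻¹-cong W-n)) ⟨
      y K * (W 0 / W n)
        ≈⟨ I.y′-now ⟨
      y′ K ∎

    value-L : y₂ K ≈ y′ L
    value-L = begin
      y₂ K
        ≈⟨ trans y₂-K (⁻¹-cong I.y-now) ⟩
      (P (suc N) / ΣP N) ⁻¹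
        ≈⟨ solve 4 (λ p s d w → neg (p ⊖ s) ⊜ ((d ⊕ s) ⊖ p) ⊕ (w ⊖ (w ⊕ d))) ≡.refl (P (suc N) ∷ ΣP N ∷ D ∷ W (suc N) ∷ []) ⟩
      ((D * ΣP N) / P (suc N)) * (W (suc N) / (W (suc N) * D))
        ≈⟨ *-congʳ yL≈ ⟨
      y L * (W (suc N) / (W (suc N) * D))
        ≈⟨ I.y′-last ⟨
      y′ L ∎

    value-other : ∀ {u} → u ≢ K → u ≢ L → y₂ u ≈ y′ u
    value-other {u} u≢K u≢L with I.settled u (other-settled u≢K u≢L)
    ... | p , q , r , e = by (end (Row.k≤p r) (Row.p<n r)) (end (Row.k≤q r) (Row.q<n r)) r e
      where
      fixed : ∀ {w} → B u K ≡ + 0 → y′ u ≈ y u * (w / w) → y₂ u ≈ y′ u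
      fixed {w} uK e = begin
        y₂ u           ≈⟨ y₂-other (+ 0) u≢K u≢L uK ⟩
        exchange (+ 0) (exchange (+ 0) (y u) (y K)) (y L) ≈⟨ trans (exchange-zero _ (y L)) (exchange-zero (y u) (y K)) ⟩
        y u            ≈⟨ trans (*-congˡ (inverseʳ w)) (identityʳ (y u)) ⟨
        y u * (w / w)  ≈⟨ e ⟨
        y′ u           ∎
      by : ∀ {p q} → End p → End q → Row B N u p q → y u ⟶ y′ u by p , q → y₂ u ≈ y′ u
      by atN   atN   r (up _ e) = fixed (≡.trans (atK r) (ℤP.+-inverseʳ (δ N N))) e
      by at1+N at1+N r (up _ e) = fixed (≡.trans (atK r) (ℤP.+-inverseʳ (δ (suc N) N))) e
      by at1+N atN   r (up 1+N≤N _) = contradiction 1+N≤N ℕP.1+n≰n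
      by atN   atN   r (wrap N<N _) = contradiction N<N (ℕP.<-irrefl ≡.refl)
      by at1+N at1+N r (wrap N<N _) = contradiction N<N (ℕP.<-irrefl ≡.refl)
      by atN   at1+N r (wrap 1+N<N _) = contradiction (ℕP.<⇒≤ 1+N<N) ℕP.1+n≰n
      -- One arrow from `u` to `K` and one from `L` to `u`: the sums `ΣP N` and `P (suc N)` drop out
      -- of the product of the two factors, and only values of `W` and `D` remain.
      by atN   at1+N r (up _ e) = begin
        y₂ u
          ≈⟨ y₂-other (+ 1) u≢K u≢L (≡.trans (atK r) (cong₂ ℤ._-_ δNN δLN)) ⟩
        exchange -[1+ 0 ] (exchange (+ 1) (y u) (y K)) (y L)
          ≈⟨ trans (exchange-minus-one _ (y L)) (*-congʳ (exchange-one (y u) (y K))) ⟩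
        (y u * (1# + y K)) * (y L / (1# + y L))
          ≈⟨ *-cong (*-congˡ 1+yK) (*-cong yL≈ (⁻¹-cong 1+yL)) ⟩
        (y u * (W 0 / ΣP N)) * (((D * ΣP N) / P (suc N)) / (W (suc N) / P (suc N)))
          ≈⟨ solve 6 (λ y w₀ s d p w₁ → (y ⊕ (w₀ ⊖ s)) ⊕ (((d ⊕ s) ⊖ p) ⊖ (w₁ ⊖ p)) ⊜ y ⊕ ((d ⊕ w₀) ⊖ w₁)) ≡.refl
               (y u ∷ W 0 ∷ ΣP N ∷ D ∷ P (suc N) ∷ W (suc N) ∷ []) ⟩
        y u * ((D * W 0) / W (suc N))
          ≈⟨ *-congˡ (*-congʳ W-n) ⟨
        y u * (W n / W (suc N))
          ≈⟨ e ⟨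
        y′ u ∎
      by at1+N atN   r (wrap _ e) = begin
        y₂ u
          ≈⟨ y₂-other -[1+ 0 ] u≢K u≢L (≡.trans (atK r) (cong₂ ℤ._-_ δLN δNN)) ⟩
        exchange (+ 1) (exchange -[1+ 0 ] (y u) (y K)) (y L)
          ≈⟨ trans (exchange-one _ (y L)) (*-congʳ (exchange-minus-one (y u) (y K))) ⟩
        (y u * (y K / (1# + y K))) * (1# + y L)
          ≈⟨ *-cong (*-congˡ (*-cong I.y-now (⁻¹-cong 1+yK))) 1+yL ⟩
        (y u * ((P (suc N) / ΣP N) / (W 0 / ΣP N))) * (W (suc N) / P (suc N))
          ≈⟨ solve 6 (λ y w₀ s d p w₁ → (y ⊕ ((p ⊖ s) ⊖ (w₀ ⊖ s))) ⊕ (w₁ ⊖ p) ⊜ y ⊕ (d ⊕ (w₁ ⊖ (d ⊕ w₀)))) ≡.refl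
               (y u ∷ W 0 ∷ ΣP N ∷ D ∷ P (suc N) ∷ W (suc N) ∷ []) ⟩
        y u * (D * (W (suc N) / (D * W 0)))
          ≈⟨ *-congˡ (*-congˡ (*-congˡ (⁻¹-cong W-n))) ⟨
        y u * (D * (W (suc N) / W n))
          ≈⟨ e ⟨
        y′ u ∎

    values-fixed : ∀ u → y₂ (sw u) ≈ y′ u
    values-fixed u = by (position u)
      where
      by : ∀ {u} → Position u → y₂ (sw u) ≈ y′ u
      by isK = trans (reflexive (cong y₂ sw-K)) value-K
      by isL = trans (reflexive (cong y₂ sw-L)) value-L
      by (other a b) = trans (reflexive (cong y₂ (sw-other a b))) (value-other a b)

    middle : swapSeed K L s₂ ≃ yseed B y′
    middle = record
      { col = λ u j → quiver-fixed u (vc j)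
      ; row = λ j u → quiver-fixed (vc j) u
      ; yv  = values-fixed }

-- The invariant at the start, and the comparison of the two runs

n-mod-n : ∀ n ⦃ _ : NonZero n ⦄ → toℕ (n mod n) ≡ 0
n-mod-n n@(suc _) = ≡.trans (cong (λ k → toℕ (k mod n)) (≡.sym (ℕP.+-identityʳ n)))
  (≡.trans (cong toℕ (mod-+ n 0)) (toℕ-mod n ℕ.z<s))

suc-mod-injective : ∀ {i j} n ⦃ _ : NonZero n ⦄ → i < n → j < n →
                    toℕ (suc i mod n) ≡ toℕ (suc j mod n) → i ≡ j
suc-mod-injective {i} {j} n i<n j<n e with ℕP.m≤n⇒m<n∨m≡n i<n | ℕP.m≤n⇒m<n∨m≡n j<n
... | inj₁ 1+i<n  | inj₁ 1+j<n  = ℕP.suc-injective (≡.trans (≡.sym (toℕ-mod n 1+i<n)) (≡.trans e (toℕ-mod n 1+j<n)))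
... | inj₁ 1+i<n  | inj₂ ≡.refl = contradiction (≡.trans (≡.sym (toℕ-mod n 1+i<n)) (≡.trans e (n-mod-n n))) λ ()
... | inj₂ ≡.refl | inj₁ 1+j<n  = contradiction (≡.trans (≡.sym (toℕ-mod n 1+j<n)) (≡.trans (≡.sym e) (n-mod-n n))) λ ()
... | inj₂ ≡.refl | inj₂ e′     = ≡.sym (ℕP.suc-injective e′)

module Conclusion {c₁ ℓ₁ : Level} (S : Semifield c₁ ℓ₁) (N ℓ m : ℕ) ⦃ _ : NonZero ℓ ⦄ ⦃ _ : NonZero m ⦄
    (2≤ℓ : 2 ≤ ℓ) (2≤m : 2 ≤ m)
    (α : Fin ℓ → Fin (2 ℕ.+ N)) (β : Fin m → Fin (2 ℕ.+ N))
    (α-mono : ∀ i j → i Fin.< j → α i Fin.< α j)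
    (α-last : ∀ j → suc (toℕ j) ≡ ℓ → suc (toℕ (α j)) ≡ 2 ℕ.+ N)
    (β-mono : ∀ i j → i Fin.< j → β i Fin.< β j)
    (β-first : ∀ j → toℕ j ≡ 0 → toℕ (β j) ≡ 0)
    (t : Semifield.Carrier S)
    (a : Fin ℓ → Semifield.Carrier S)
    (b : Fin m → Semifield.Carrier S)
    (c : Fin (2 ℕ.+ N) → Semifield.Carrier S)
    (total-weight : Semifield._≈_ S
        (Semifield._*_ S (Semifield._*_ S (YSeeds.prodF S a) (YSeeds.prodF S b)) (YSeeds.prodF S c))
        (Semifield.1# S)) where
  open Semifield S renaming (_≈_ to infix 4 _≈_; _⁻¹ to infixl 8 _⁻¹)
  open YSeeds S renaming (_/_ to infixl 7 _/_)
  open SemifieldProperties S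
  open Network S (2 ℕ.+ N) ℓ m α β t a b c
  open DualQuiver S (2 ℕ.+ N) ℓ m α β t a b c using (Q-a; Q-b; Q-c)
  open MonotoneWeights S (suc N) ℓ m 2≤ℓ 2≤m α β α-mono α-last β-mono β-first t a b c total-weight
  open Seeds S {ℓ} {m} {2 ℕ.+ N}
  open Forward S N ℓ m c
  open Run S N ℓ m c
  open Middle S N ℓ m c using (middle)
  open import Relation.Binary.Reasoning.Setoid setoid

  -- `Q-c` describes the arrow into `C j` through the successor of the column index; injectivity of
  -- the cyclic successor turns this into a unit vector at the predecessor `q` of `j`.
  row-c : ∀ {j p q} → j < n → p < n → q < n → toℕ [ suc j ]ₙ ≡ p → toℕ [ suc q ]ₙ ≡ j → Row Q 0 (C j) p q
  row-c {j} {p} {q} j<n p<n q<n sj≡p sq≡j = record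
    { k≤p = ℕ.z≤n ; k≤q = ℕ.z≤n ; p<n = p<n ; q<n = q<n
    ; entry = λ i _ → ≡.trans (Q-c [ j ]ₙ i) (cong₂ ℤ._-_
        (cong (λ r → δ r (toℕ i)) (≡.trans (cong (λ k → toℕ [ suc k ]ₙ) (C-index j<n)) sj≡p))
        (cong (λ d → + indicator d) (does-⇔ (mk⇔
            (λ e → suc-mod-injective n q<n (toℕ<n i) (≡.trans sq≡j (≡.sym (≡.trans e (C-index j<n)))))
            (λ { ≡.refl → ≡.trans sq≡j (≡.sym (C-index j<n)) }))
          (toℕ [ suc (toℕ i) ]ₙ ℕ.≟ toℕ [ j ]ₙ) (q ℕ.≟ toℕ i)))) }

  c′-at : ∀ {j} → j < n → c′ [ j ]ₙ ≈ c [ j ]ₙ * (W j / W (2 ℕ.+ j))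
  c′-at {j} j<n = trans (c′-value [ j ]ₙ) (reflexive (cong (λ k → c [ j ]ₙ * (W k / W (2 ℕ.+ k))) (C-index j<n)))

  initial : Invariant 0 Q faceWeight Tf
  initial = record
    { skew      = quiverOf-skew arrows
    ; row-now   = row-c ℕ.z<s (ℕ.s≤s ℕ.z<s) ℕP.≤-refl (C-index (ℕ.s≤s ℕ.z<s)) (n-mod-n n)
    ; y-now     = solve 1 (λ x → x ⊜ (x ⊕ zero) ⊖ zero) ≡.refl (c [ 0 ]ₙ ∷ [])
    ; y′-now    = c′-at ℕ.z<s
    ; row-later = row-later
    ; y-later   = λ _ _ _ → refl
    ; y′-later  = λ j _ j≤N → c′-at (ℕ.s≤s (ℕP.m≤n⇒m≤1+n j≤N))
    ; row-last  = row-c ℕP.≤-refl ℕ.z<s (ℕP.m<n+m N ℕ.z<s) (n-mod-n n) (C-index ℕP.≤-refl)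
    ; y-last    = sym (identityʳ _)
    -- The index `2 + j` of `c′-at` is here `n + 1`, past the cut; this is where the `D ⁻¹` in the
    -- field for the last vertex comes from.
    ; y′-last   = trans (c′-at ℕP.≤-refl) (*-congˡ (*-congˡ (⁻¹-cong (begin
        W (3 ℕ.+ N)   ≡⟨ cong W (ℕP.+-comm n 1) ⟨
        W (n ℕ.+ 1)   ≈⟨ W-periodic 1 ⟩
        D * W 1       ≈⟨ *-comm D (W 1) ⟩
        W 1 * D       ∎))))
    ; settled   = settled }
    where
    row-later : ∀ j → 0 < j → j ≤ N → Row Q 0 (C j) (suc j) (j ∸ 1)
    row-later (suc j) _ j<N = row-c 1+j<n (ℕ.s≤s (ℕ.s≤s j<N)) (ℕP.<⇒≤ 1+j<n)
        (C-index (ℕ.s≤s (ℕ.s≤s j<N))) (C-index 1+j<n)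
      where
      1+j<n : suc j < n
      1+j<n = ℕ.s≤s (ℕP.m≤n⇒m≤1+n j<N)
    settled : ∀ u → Settled 0 u → ∃₂ λ p q → Row Q 0 u p q × (faceWeight u ⟶ Tf u by p , q)
    settled (va j) _ = _ , _ , record { k≤p = ℕ.z≤n ; k≤q = ℕ.z≤n ; p<n = toℕ<n _ ; q<n = toℕ<n _
                                      ; entry = λ i _ → Q-a j i } , a′-value j
    settled (vb j) _ = _ , _ , record { k≤p = ℕ.z≤n ; k≤q = ℕ.z≤n ; p<n = toℕ<n _ ; q<n = toℕ<n _
                                      ; entry = λ i _ → Q-b j i } , b′-value j
    settled (vc i) set = contradiction (set i ≡.refl) λ ()

  -- Mutation of the quiver ignores the weights, so this one sequence serves both the run from the
  -- face weights and the run from their images.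
  quiverAt : ℕ → Mat {ℓ} {m} {n}
  quiverAt zero    = Q
  quiverAt (suc k) = mutQ (C k) (quiverAt k)

  weightsAt : (Vtx ℓ m n → Carrier) → ℕ → Vtx ℓ m n → Carrier
  weightsAt y zero    = y
  weightsAt y (suc k) = yvar (μ (C k) (yseed (quiverAt k) (weightsAt y k)))

  seedAt : (Vtx ℓ m n → Carrier) → ℕ → YSeed {ℓ} {m} {n}
  seedAt y k = yseed (quiverAt k) (weightsAt y k)

  quiverAt-skew : ∀ k → Skew (quiverAt k)
  quiverAt-skew zero    = quiverOf-skew arrows
  quiverAt-skew (suc k) = mutQ-skew (C k) (quiverAt k) (quiverAt-skew k)

  ascend : ∀ y k → mutateAll (upTo k) (yseed Q y) ≡ seedAt y k
  ascend y zero    = ≡.refl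
  ascend y (suc k) = ≡.trans (cong (λ ks → mutateAll ks (yseed Q y)) (≡.sym (upTo-∷ʳ k)))
    (≡.trans (foldl-∷ʳ (λ s j → μ (C j) s) (yseed Q y) k (upTo k)) (cong (μ (C k)) (ascend y k)))

  descend : ∀ y k {s} → s ≃ seedAt y k → mutateAll (downFrom k) s ≃ yseed Q y
  descend y zero    e = e
  descend y (suc k) e = descend y k (≃-trans (μ-cong [ k ]ₙ e) (μ-involutive [ k ]ₙ (seedAt y k) (quiverAt-skew k)))

  invariant : ∀ k → k ≤ N → Invariant k (quiverAt k) (weightsAt faceWeight k) (weightsAt Tf k)
  invariant zero    _   = initial
  invariant (suc k) k<N = step k k<N (quiverAt k) (weightsAt faceWeight k) (weightsAt Tf k)
                               (invariant k (ℕP.<⇒≤ k<N))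

  τ≃Tf : τ initialSeed ≃ yseed Q Tf
  -- Of the `n` ascending mutations the last two belong to σ: `seedAt faceWeight n` unfolds to the
  -- seed at `N` mutated at `C N` and `C (suc N)`, which is what `middle` swaps.
  τ≃Tf = descend Tf N (≡.subst (λ s → swapSeed (C N) (C (suc N)) s ≃ seedAt Tf N) (≡.sym (ascend faceWeight n))
    (middle (quiverAt N) (weightsAt faceWeight N) (weightsAt Tf N) (invariant N ℕP.≤-refl)))

theorem7p2 : ∀ {c₁ ℓ₁ : Level} (S : Semifield c₁ ℓ₁)
    (n ℓ m : ℕ) ⦃ _ : NonZero n ⦄ ⦃ _ : NonZero ℓ ⦄ ⦃ _ : NonZero m ⦄
    → 2 ≤ ℓ → 2 ≤ m
    → (α : Fin ℓ → Fin n) → (β : Fin m → Fin n)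
    → (∀ i j → i Fin.< j → α i Fin.< α j)
    → (∀ j → suc (toℕ j) ≡ ℓ → suc (toℕ (α j)) ≡ n)
    → (∀ i j → i Fin.< j → β i Fin.< β j)
    → (∀ j → toℕ j ≡ 0 → toℕ (β j) ≡ 0)
    → (t : Semifield.Carrier S)
    → (a : Fin ℓ → Semifield.Carrier S)
    → (b : Fin m → Semifield.Carrier S)
    → (c : Fin n → Semifield.Carrier S)
    → Semifield._≈_ S
        (Semifield._*_ S (Semifield._*_ S (YSeeds.prodF S a) (YSeeds.prodF S b)) (YSeeds.prodF S c))
        (Semifield.1# S)
    → ∀ (v : Vtx ℓ m n)
    → Semifield._≈_ S
        (YSeeds.YSeed.yvar (Network.τ S n ℓ m α β t a b c (Network.initialSeed S n ℓ m α β t a b c)) v)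
        (Network.Tf S n ℓ m α β t a b c v)
-- With a single middle face the association of two or more outer faces cannot be strictly
-- increasing; hence `n` is at least 2 and the two swapped vertices exist.
theorem7p2 S (suc zero) _ m (ℕ.s≤s (ℕ.s≤s _)) 2≤m α β α-mono α-last β-mono β-first t a b c total-weight v
  with α Fin.zero | α (Fin.suc Fin.zero) | α-mono Fin.zero (Fin.suc Fin.zero) ℕ.z<s
... | Fin.zero | Fin.zero | ()
theorem7p2 S (suc (suc N)) ℓ m 2≤ℓ 2≤m α β α-mono α-last β-mono β-first t a b c total-weight v =
  Seeds._≃_.yv (Conclusion.τ≃Tf S N ℓ m 2≤ℓ 2≤m α β α-mono α-last β-mono β-first t a b c total-weight) v
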